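{- Let $\pi_1,\pi_2,\pi_3,\pi_4$ be $4$-point permutations such that $A_{\pi_1}+A_{\pi_2}+A_{\pi_3}+A_{\pi_4}$ is the $4\times4$ all-one matrix, and suppose the quadruple is neither $1234,2143,3412,4321$ nor $1324,2413,3142,4231$. Then $\{\pi_1,\pi_2,\pi_3,\pi_4\}$ is not quasirandom-forcing.
   Context: A $4$-point permutation $\pi$ is written $\pi(1)\pi(2)\pi(3)\pi(4)$; $A_\pi$ is the $4\times4$ matrix with entry $1$ in row $i$ and column $\pi(i)$ for each $i$ and $0$ elsewhere. Pattern density $d(\sigma,\pi)$: probability that a uniformly random $|\sigma|$-subset $\{a_1<\dots<a_{|\sigma|}\}$ of positions of $\pi$ satisfies $\pi(a_i)<\pi(a_j)\iff\sigma(i)<\sigma(j)$. A set $S$ of permutations is quasirandom-forcing if every sequence of permutations with sizes tending to infinity and $d(\sigma,\pi_n)\to1/|\sigma|!$ for all $\sigma\in S$ has $d(\sigma,\pi_n)\to1/|\sigma|!$ for all permutations $\sigma$. -}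

module Defs where

open import Data.Nat using (ℕ; zero; suc; _≤_; _!)
import Data.Nat as ℕ
open import Data.Integer using (+_)
open import Data.Rational using (ℚ; 0ℚ; _/_; _-_; _<_; ∣_∣)
open import Data.Fin using (Fin; zero; suc)
import Data.Fin as Fin
open import Data.Fin.Permutation using (Permutation′; _⟨$⟩ʳ_)
open import Data.Vec using (Vec; []; _∷_; lookup; tabulate)
import Data.Vec as Vec
open import Data.List using (List; []; _∷_; _++_; map; length; filter)
open import Data.List.Relation.Unary.All using (All)
open import Data.Bool using (Bool; true; false; _∧_; if_then_else_)
open import Data.Product using (Σ; ∃; _×_; _,_; proj₁; proj₂)
open import Relation.Binary.PropositionalEquality using (_≡_)
open import Relation.Nullary.Decidable using (⌊_⌋)
import Data.Bool as Bool

frac : ℕ → ℕ → ℚ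
frac a zero    = 0ℚ
frac a (suc b) = (+ a) / suc b

-- all strictly increasing k-tuples (a₁ < … < aₖ) of positions in Fin n,
-- i.e. all k-subsets of Fin n, listed once each
increasing : (k n : ℕ) → List (Vec (Fin n) k)
increasing zero    n       = [] ∷ []
increasing (suc k) zero    = []
increasing (suc k) (suc n) =
  map (Vec.map suc) (increasing (suc k) n) ++
  map (λ t → zero ∷ Vec.map suc t) (increasing k n)

_<ᵇ_ : ∀ {n} → Fin n → Fin n → Bool
i <ᵇ j = ⌊ i Fin.<? j ⌋

allᵇ : ∀ {k} → (Fin k → Bool) → Bool
allᵇ {k} p = Vec.foldr _ _∧_ true (tabulate p)

occursAt : ∀ {k n} → Permutation′ k → Permutation′ n → Vec (Fin n) k → Bool
occursAt σ π a =
  allᵇ λ i → allᵇ λ j →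
    ⌊ ((π ⟨$⟩ʳ lookup a i) <ᵇ (π ⟨$⟩ʳ lookup a j)) Bool.≟ ((σ ⟨$⟩ʳ i) <ᵇ (σ ⟨$⟩ʳ j)) ⌋

density : ∀ {k n} → Permutation′ k → Permutation′ n → ℚ
density {k} {n} σ π =
  frac (length (filter (λ a → occursAt σ π a Bool.≟ true) (increasing k n)))
       (length (increasing k n))

Perm : Set
Perm = Σ ℕ Permutation′

_⟶_ : (ℕ → ℚ) → ℚ → Set
x ⟶ L = ∀ (ε : ℚ) → 0ℚ < ε → ∃ λ N → ∀ m → N ≤ m → ∣ x m - L ∣ < ε

SizesToInfinity : (ℕ → Perm) → Set
SizesToInfinity s = ∀ M → ∃ λ N → ∀ m → N ≤ m → M ≤ proj₁ (s m)

DensityQuasirandom : (ℕ → Perm) → Perm → Set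
DensityQuasirandom s (k , σ) = (λ m → density σ (proj₂ (s m))) ⟶ frac 1 (k !)

QuasirandomForcing : List Perm → Set
QuasirandomForcing S =
  ∀ (s : ℕ → Perm) → SizesToInfinity s →
  All (DensityQuasirandom s) S →
  ∀ (τ : Perm) → DensityQuasirandom s τ

A : ∀ {n} → Permutation′ n → Fin n → Fin n → ℕ
A π i j = if ⌊ (π ⟨$⟩ʳ i) Fin.≟ j ⌋ then 1 else 0

-- one-line notation π(1)π(2)π(3)π(4), values shifted to 0-indexed Fin 4
oneLine : Permutation′ 4 → Vec (Fin 4) 4
oneLine π = tabulate (π ⟨$⟩ʳ_)

-- literal one-line notations (digits shifted down by one)
w1234 w2143 w3412 w4321 w1324 w2413 w3142 w4231 : Vec (Fin 4) 4
w1234 = Fin.# 0 ∷ Fin.# 1 ∷ Fin.# 2 ∷ Fin.# 3 ∷ []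
w2143 = Fin.# 1 ∷ Fin.# 0 ∷ Fin.# 3 ∷ Fin.# 2 ∷ []
w3412 = Fin.# 2 ∷ Fin.# 3 ∷ Fin.# 0 ∷ Fin.# 1 ∷ []
w4321 = Fin.# 3 ∷ Fin.# 2 ∷ Fin.# 1 ∷ Fin.# 0 ∷ []
w1324 = Fin.# 0 ∷ Fin.# 2 ∷ Fin.# 1 ∷ Fin.# 3 ∷ []
w2413 = Fin.# 1 ∷ Fin.# 3 ∷ Fin.# 0 ∷ Fin.# 2 ∷ []
w3142 = Fin.# 2 ∷ Fin.# 0 ∷ Fin.# 3 ∷ Fin.# 1 ∷ []
w4231 = Fin.# 3 ∷ Fin.# 1 ∷ Fin.# 2 ∷ Fin.# 0 ∷ []

{-# OPTIONS --safe #-}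
module Submission where

-- Replace every entry of a fixed permutation by an increasing or decreasing run
-- of length m.  As m → ∞, the density of a pattern σ of size k in this inflation
-- tends to P / Q, where Q = nᵏ and P counts the weakly increasing k-tuples of
-- positions that agree with σ, a tuple with multiplicities c₁, c₂, … having
-- weight k! / (c₁! c₂! …).  Both numbers are finite sums, so limit densities can
-- be computed exactly.  For each of the 22 quadruples other than the two
-- exceptional ones there is a permutation of size 12 or 24 such that its four
-- patterns have limit density exactly 1/24 whereas 123 does not have limit
-- density 1/6.

open import Defs
open import Data.Nat using (ℕ; zero; suc; _+_; _*_; _∸_; _^_; _!; _/_; _⊔_; _≡ᵇ_; _≤_; _<_; z≤n; s≤s; z<s; s<s; s<s⁻¹; ∣_-_∣; NonZero)
import Data.Nat as ℕ
open import Data.Nat.Properties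
import Data.Nat.Properties as ℕ
open import Data.Nat.Combinatorics using (_C_; nCk≡n!/k![n-k]!; k>n⇒nCk≡0; [n∸k]!k!∣n!; nCk+nC[k+1]≡[n+1]C[k+1])
open import Data.Nat.Coprimality using (Coprime)
open import Data.Nat.Divisibility using (_∣_)
open import Data.Nat.DivMod using (m/n*n≡m; _mod_)
open import Data.Nat.ListAction using (sum)
open import Data.Nat.ListAction.Properties using (sum-++)
open import Data.Nat.Tactic.RingSolver using (solve-∀)
open import Data.Integer using (+[1+_]; -[1+_]; _⊖_)
import Data.Integer as ℤ
import Data.Integer.Properties as ℤ
open import Data.Rational using (mkℚ; 0ℚ; ½; toℚᵘ)
import Data.Rational as ℚ
import Data.Rational.Properties as ℚ
open import Data.Rational.Solver using (module +-*-Solver)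
open import Data.Rational.Unnormalised using (ℚᵘ; mkℚᵘ; *≡*)
import Data.Rational.Unnormalised as ℚᵘ
import Data.Rational.Unnormalised.Properties as ℚᵘ
open import Data.Bool using (Bool; true; false; not; _∧_; if_then_else_)
import Data.Bool as Bool
open import Data.Bool.ListAction using (all)
open import Data.Bool.Properties using (T-≡; ¬-not)
open import Data.Fin using (Fin; zero; suc; #_; toℕ; combine; remQuot; quotient; opposite; _↑ˡ_; _↑ʳ_)
import Data.Fin as Fin
import Data.Fin.Properties as Fin
open import Data.Fin.Permutation using (Permutation′; permutation; id; _⟨$⟩ʳ_; _⟨$⟩ˡ_; inverseʳ; inverseˡ)
open import Data.Vec using (Vec; []; _∷_; lookup; toList)
import Data.Vec as Vec
import Data.Vec.Properties as Vec
open import Data.List using (List; []; _∷_; _++_; map; length; filter; tabulate; replicate; concatMap; allFin)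
open import Data.List.Properties using (map-∘; map-cong; map-++; tabulate-cong)
open import Data.List.Membership.DecPropositional (Vec.≡-dec {n = 4} (Fin._≟_ {4})) using (_∈?_)
open import Data.List.Membership.Propositional using (_∈_; find; lose)
open import Data.List.Membership.Propositional.Properties using (∈-∃++; ∈-filter⁺; ∈-map⁺; ∈-concatMap⁺; ∈-allFin)
open import Data.List.Relation.Binary.Permutation.Propositional using (_↭_; ↭-refl; ↭-trans; ↭-sym; prep)
open import Data.List.Relation.Binary.Permutation.Propositional.Properties using (shift)
open import Data.List.Relation.Unary.All using (All; []; _∷_; all?)
import Data.List.Relation.Unary.All as All
import Data.List.Relation.Unary.All.Properties as All
open import Data.List.Relation.Unary.Any using (Any; any?; here; there)
open import Data.Maybe using (Maybe; just; nothing; is-just; to-witness-T; _<∣>_)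
import Data.Maybe as Maybe
open import Data.Product using (_×_; _,_; proj₁; proj₂)
open import Data.Sum using (_⊎_; inj₁; inj₂; [_,_]′)
open import Function using (_∘_; Equivalence; Injection)
open import Function.Properties.Inverse using (↔⇒↣)
open import Relation.Binary using (tri<; tri≈; tri>)
open import Relation.Binary.PropositionalEquality
open import Relation.Nullary using (¬_; Dec; yes; no; contradiction)
open import Relation.Nullary.Decidable using (toWitness; _→-dec_; _×-dec_; ¬?; ⌊_⌋; isYes≗does; dec⇒maybe)

-- Sums over sublists of an inflated list

-- Monotone runs make the order of two points a function of their blocks alone, even when both
-- points lie in one run. Being an occurrence is therefore a property of the list of chosen blocks,
-- and the number `m C c` of ways to choose `c` points in a run, close to mᶜ / c!, accounts for the
-- multinomial weights. Geometrically, the limit is the permuton carried by a diagonal or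
-- antidiagonal of each nonzero cell of the permutation matrix; inflations approach it
-- deterministically, without random sampling. To keep the analysis in ℕ, k! times a count is
-- squeezed between eᵏ P and (e + K)ᵏ P for runs of length e + K. The number of all k-subsets is the
-- same kind of sum with constant weight 1, so the same squeeze produces the denominator Q, and the
-- density is off by O(1 / e). Exactness restricts the skeletons: 24 P = n⁴ with an integer P forces
-- 6 to divide n.

conv : ℕ → (ℕ → ℕ → ℕ) → ℕ
conv zero    h = h 0 0
-- The pairs with `c + d = k` are listed by raising `c`, which avoids the truncated difference
-- `k ∸ c`.
conv (suc k) h = h 0 (suc k) + conv k (λ c d → h (suc c) d)

conv-mono : ∀ k {h h′ : ℕ → ℕ → ℕ} → (∀ c d → c + d ≡ k → h c d ≤ h′ c d) → conv k h ≤ conv k h′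
conv-mono zero    le = le 0 0 refl
conv-mono (suc k) le = +-mono-≤ (le 0 (suc k) refl) (conv-mono k λ c d eq → le (suc c) d (cong suc eq))

conv-cong : ∀ k {h h′ : ℕ → ℕ → ℕ} → (∀ c d → h c d ≡ h′ c d) → conv k h ≡ conv k h′
conv-cong zero    eq = eq 0 0
conv-cong (suc k) eq = cong₂ _+_ (eq 0 (suc k)) (conv-cong k λ c d → eq (suc c) d)

conv-* : ∀ k a (h : ℕ → ℕ → ℕ) → a * conv k h ≡ conv k (λ c d → a * h c d)
conv-* zero    a h = refl
conv-* (suc k) a h = trans (*-distribˡ-+ a (h 0 (suc k)) _) (cong (a * h 0 (suc k) +_) (conv-* k a _))

conv-+ : ∀ k (h h′ : ℕ → ℕ → ℕ) → conv k h + conv k h′ ≡ conv k (λ c d → h c d + h′ c d)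
conv-+ zero    h h′ = refl
conv-+ (suc k) h h′ = trans (interchange (h 0 (suc k)) _ _ _) (cong (h 0 (suc k) + h′ 0 (suc k) +_) (conv-+ k _ _))
  where
  interchange : ∀ a b c d → (a + b) + (c + d) ≡ (a + c) + (b + d)
  interchange = solve-∀

conv-0 : ∀ k → conv k (λ _ _ → 0) ≡ 0
conv-0 zero    = refl
conv-0 (suc k) = conv-0 k

choose-! : ∀ {n k} → k ≤ n → (n C k) * (k ! * (n ∸ k) !) ≡ n !
choose-! {n} {k} k≤n = begin
  (n C k) * (k ! * (n ∸ k) !)                      ≡⟨ cong (_* (k ! * (n ∸ k) !)) (nCk≡n!/k![n-k]! k≤n) ⟩
  (n ! / (k ! * (n ∸ k) !)) * (k ! * (n ∸ k) !)    ≡⟨ m/n*n≡m (subst (λ x → x ∣ n !) (*-comm ((n ∸ k) !) (k !)) ([n∸k]!k!∣n! k≤n)) ⟩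
  n !                                              ∎
  where
  open ≡-Reasoning
  instance _ = k !* (n ∸ k) !≢0

-- The quotient of `(c + d) !` by `d !` is a product of `c` factors, each between `d` and `c + d`.
-- This bound and `!-lower` say so without division.
!-upper : ∀ c d → (c + d) ! ≤ (c + d) ^ c * d !
!-upper zero    d = ≤-reflexive (sym (*-identityˡ (d !)))
!-upper (suc c) d = begin
  suc (c + d) * (c + d) !                   ≤⟨ *-monoʳ-≤ (suc (c + d)) (!-upper c d) ⟩
  suc (c + d) * ((c + d) ^ c * d !)         ≤⟨ *-monoʳ-≤ (suc (c + d)) (*-monoˡ-≤ (d !) (^-monoˡ-≤ c (n≤1+n (c + d)))) ⟩
  suc (c + d) * (suc (c + d) ^ c * d !)     ≡⟨ *-assoc (suc (c + d)) (suc (c + d) ^ c) (d !) ⟨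
  suc (c + d) ^ suc c * d !                 ∎
  where open ≤-Reasoning

!-lower : ∀ c d → d ^ c * d ! ≤ (c + d) !
!-lower zero    d = ≤-reflexive (*-identityˡ (d !))
!-lower (suc c) d = begin
  d * d ^ c * d !          ≡⟨ *-assoc d (d ^ c) (d !) ⟩
  d * (d ^ c * d !)        ≤⟨ *-mono-≤ (≤-trans (m≤n+m d c) (n≤1+n (c + d))) (!-lower c d) ⟩
  suc (c + d) * (c + d) !  ∎
  where open ≤-Reasoning

choose-upper : ∀ n k → k ! * (n C k) ≤ n ^ k
choose-upper n k with k ≤? n
... | no k≰n rewrite k>n⇒nCk≡0 (≰⇒> k≰n) | *-zeroʳ (k !) = z≤n
... | yes k≤n = *-cancelʳ-≤ _ _ ((n ∸ k) !) (begin
  k ! * (n C k) * (n ∸ k) !    ≡⟨ rearrange (k !) (n C k) _ ⟩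
  (n C k) * (k ! * (n ∸ k) !)  ≡⟨ choose-! k≤n ⟩
  n !                          ≡⟨ cong _! (m+[n∸m]≡n k≤n) ⟨
  (k + (n ∸ k)) !              ≤⟨ !-upper k (n ∸ k) ⟩
  (k + (n ∸ k)) ^ k * (n ∸ k) ! ≡⟨ cong (λ x → x ^ k * (n ∸ k) !) (m+[n∸m]≡n k≤n) ⟩
  n ^ k * (n ∸ k) !            ∎)
  where
  open ≤-Reasoning
  instance _ = (n ∸ k) !≢0
  rearrange : ∀ a b c → a * b * c ≡ b * (a * c)
  rearrange = solve-∀

choose-lower : ∀ n k → (n ∸ k) ^ k ≤ k ! * (n C k)
choose-lower n k with k ≤? n
... | no k≰n = vanish (≰⇒> k≰n)
  where
  vanish : ∀ {k} → n < k → (n ∸ k) ^ k ≤ k ! * (n C k)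
  -- From `n < k` it follows that `k` is positive, so the truncated difference gives 0 ^ k = 0; for
  -- `k = 0` the power would be 1.
  vanish {suc k} n<k rewrite m≤n⇒m∸n≡0 (<⇒≤ n<k) = z≤n
... | yes k≤n = *-cancelʳ-≤ _ _ ((n ∸ k) !) (begin
  (n ∸ k) ^ k * (n ∸ k) !      ≤⟨ !-lower k (n ∸ k) ⟩
  (k + (n ∸ k)) !              ≡⟨ cong _! (m+[n∸m]≡n k≤n) ⟩
  n !                          ≡⟨ choose-! k≤n ⟨
  (n C k) * (k ! * (n ∸ k) !)  ≡⟨ rearrange (n C k) (k !) _ ⟩
  k ! * (n C k) * (n ∸ k) !    ∎)
  where
  open ≤-Reasoning
  instance _ = (n ∸ k) !≢0
  rearrange : ∀ a b c → a * (b * c) ≡ b * a * c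
  rearrange = solve-∀

-- Sublists are taken by position, so equal entries count separately. The recursion is that of
-- `increasing`, and the entries chosen so far are absorbed into `g`.
sublistSum : ∀ {B : Set} → ℕ → List B → (List B → ℕ) → ℕ
sublistSum zero    xs       g = g []
sublistSum (suc k) []       g = 0
sublistSum (suc k) (x ∷ xs) g = sublistSum (suc k) xs g + sublistSum k xs (g ∘ (x ∷_))

-- Only the number `c` of entries chosen among the `m` equal ones is visible to `g`, hence the
-- factor `m C c`. The induction on `m` is Pascal's rule.
sublistSum-replicate : ∀ {B : Set} k m (b : B) xs g →
  sublistSum k (replicate m b ++ xs) g ≡
  conv k (λ c d → (m C c) * sublistSum d xs (g ∘ (replicate c b ++_)))
sublistSum-replicate zero zero b xs g = sym (+-identityʳ _)
sublistSum-replicate (suc k) zero b xs g = sym (trans (cong₂ _+_ (+-identityʳ _) (conv-0 k)) (+-identityʳ _))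
sublistSum-replicate zero (suc m) b xs g = sym (+-identityʳ _)
sublistSum-replicate (suc k) (suc m) b xs g = begin
  sublistSum (suc k) (replicate m b ++ xs) g + sublistSum k (replicate m b ++ xs) (g ∘ (b ∷_))
    ≡⟨ cong₂ _+_ (sublistSum-replicate (suc k) m b xs g) (sublistSum-replicate k m b xs (g ∘ (b ∷_))) ⟩
  (h₀ + conv k (λ c d → (m C suc c) * X c d)) + conv k (λ c d → (m C c) * X c d)
    ≡⟨ +-assoc h₀ _ _ ⟩
  h₀ + (conv k (λ c d → (m C suc c) * X c d) + conv k (λ c d → (m C c) * X c d))
    ≡⟨ cong (h₀ +_) (conv-+ k _ _) ⟩
  h₀ + conv k (λ c d → (m C suc c) * X c d + (m C c) * X c d)
    ≡⟨ cong (h₀ +_) (conv-cong k λ c d → trans (sym (*-distribʳ-+ (X c d) (m C suc c) (m C c)))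
         (cong (_* X c d) (trans (+-comm (m C suc c) (m C c)) (nCk+nC[k+1]≡[n+1]C[k+1] m c)))) ⟩
  h₀ + conv k (λ c d → (suc m C suc c) * X c d) ∎
  where
  open ≡-Reasoning
  X : ℕ → ℕ → ℕ
  X c d = sublistSum d xs (g ∘ (replicate (suc c) b ++_))
  h₀ = 1 * sublistSum (suc k) xs g

inflate : ∀ {B : Set} → ℕ → List B → List B
inflate m []       = []
inflate m (b ∷ bs) = replicate m b ++ inflate m bs

-- Multiplying the binomial coefficients along the recursion gives a list with
-- multiplicities c₁, c₂, … the weight k! / (c₁! c₂! …).
weightedSum : ∀ {B : Set} → ℕ → List B → (List B → ℕ) → ℕ
weightedSum zero    bs       g = g []
weightedSum (suc k) []       g = 0
weightedSum (suc k) (b ∷ bs) g =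
  conv (suc k) (λ c d → ((c + d) C c) * weightedSum d bs (g ∘ (replicate c b ++_)))

choose-split : ∀ c d → (c + d) ! ≡ ((c + d) C c) * (c ! * d !)
choose-split c d = sym (trans (cong (λ x → ((c + d) C c) * (c ! * x !)) (sym (m+n∸m≡n c d))) (choose-! (m≤m+n c d)))

-- A run contributes `m C c`, which is at most mᶜ / c!. Splitting `(c + d) !` into `c !` and `d !`
-- costs exactly the coefficient `(c + d) C c` that `weightedSum` carries.
sublistSum-inflate-≤ : ∀ {B : Set} k m (bs : List B) g →
  k ! * sublistSum k (inflate m bs) g ≤ m ^ k * weightedSum k bs g
sublistSum-inflate-≤ zero    m bs       g = ≤-refl
sublistSum-inflate-≤ (suc k) m []       g = ≤-reflexive (trans (*-zeroʳ (suc k !)) (sym (*-zeroʳ (m ^ suc k))))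
sublistSum-inflate-≤ k@(suc k-1) m (b ∷ bs) g = begin
  k ! * sublistSum k (replicate m b ++ inflate m bs) g
    ≡⟨ cong (k ! *_) (sublistSum-replicate k m b (inflate m bs) g) ⟩
  k ! * conv k (λ c d → (m C c) * S c d)
    ≡⟨ conv-* k (k !) (λ c d → (m C c) * S c d) ⟩
  conv k (λ c d → k ! * ((m C c) * S c d))
    ≤⟨ conv-mono k (λ c d eq → subst (λ j → j ! * ((m C c) * S c d) ≤ m ^ j * (((c + d) C c) * W c d)) eq (step c d)) ⟩
  conv k (λ c d → m ^ k * (((c + d) C c) * W c d))
    ≡⟨ conv-* k (m ^ k) (λ c d → ((c + d) C c) * W c d) ⟨
  m ^ k * conv k (λ c d → ((c + d) C c) * W c d)  ∎
  where
  open ≤-Reasoning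
  S W : ℕ → ℕ → ℕ
  S c d = sublistSum d (inflate m bs) (g ∘ (replicate c b ++_))
  W c d = weightedSum d bs (g ∘ (replicate c b ++_))
  regroup : ∀ w x y z s → w * (x * y) * (z * s) ≡ w * ((x * z) * (y * s))
  regroup = solve-∀
  regroup′ : ∀ w x y z → w * (x * (y * z)) ≡ x * y * (w * z)
  regroup′ = solve-∀
  step : ∀ c d → (c + d) ! * ((m C c) * S c d) ≤ m ^ (c + d) * (((c + d) C c) * W c d)
  step c d = begin
    (c + d) ! * ((m C c) * S c d)                           ≡⟨ cong (_* ((m C c) * S c d)) (choose-split c d) ⟩
    ((c + d) C c) * (c ! * d !) * ((m C c) * S c d)         ≡⟨ regroup ((c + d) C c) (c !) (d !) (m C c) (S c d) ⟩
    ((c + d) C c) * ((c ! * (m C c)) * (d ! * S c d))       ≤⟨ *-monoʳ-≤ ((c + d) C c) (*-mono-≤ (choose-upper m c) (sublistSum-inflate-≤ d m bs _)) ⟩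
    ((c + d) C c) * (m ^ c * (m ^ d * W c d))               ≡⟨ regroup′ ((c + d) C c) (m ^ c) (m ^ d) (W c d) ⟩
    m ^ c * m ^ d * (((c + d) C c) * W c d)                 ≡⟨ cong (_* (((c + d) C c) * W c d)) (^-distribˡ-+-* m c d) ⟨
    m ^ (c + d) * (((c + d) C c) * W c d)                   ∎

-- Here `m C c` is at least (m - c)ᶜ / c!, and `c ≤ K` makes this at least eᶜ / c! for `m = e + K`.
-- The bound `K` is kept apart from `k` because the run length stays fixed while the recursion
-- lowers `k`.
sublistSum-inflate-≥ : ∀ {B : Set} k e K (bs : List B) g → k ≤ K →
  e ^ k * weightedSum k bs g ≤ k ! * sublistSum k (inflate (e + K) bs) g
sublistSum-inflate-≥ zero    e K bs       g k≤K = ≤-refl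
sublistSum-inflate-≥ (suc k) e K []       g k≤K = ≤-reflexive (trans (*-zeroʳ (e ^ suc k)) (sym (*-zeroʳ (suc k !))))
sublistSum-inflate-≥ k@(suc k-1) e K (b ∷ bs) g k≤K = begin
  e ^ k * conv k (λ c d → ((c + d) C c) * W c d)
    ≡⟨ conv-* k (e ^ k) (λ c d → ((c + d) C c) * W c d) ⟩
  conv k (λ c d → e ^ k * (((c + d) C c) * W c d))
    ≤⟨ conv-mono k (λ c d eq → subst (λ j → e ^ j * (((c + d) C c) * W c d) ≤ j ! * ((m C c) * S c d)) eq (step c d (≤-trans (≤-reflexive eq) k≤K))) ⟩
  conv k (λ c d → k ! * ((m C c) * S c d))
    ≡⟨ conv-* k (k !) (λ c d → (m C c) * S c d) ⟨
  k ! * conv k (λ c d → (m C c) * S c d)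
    ≡⟨ cong (k ! *_) (sublistSum-replicate k m b (inflate m bs) g) ⟨
  k ! * sublistSum k (replicate m b ++ inflate m bs) g ∎
  where
  open ≤-Reasoning
  m = e + K
  S W : ℕ → ℕ → ℕ
  S c d = sublistSum d (inflate m bs) (g ∘ (replicate c b ++_))
  W c d = weightedSum d bs (g ∘ (replicate c b ++_))
  regroup : ∀ w x y z s → w * ((x * z) * (y * s)) ≡ w * (x * y) * (z * s)
  regroup = solve-∀
  regroup′ : ∀ w x y z → x * y * (w * z) ≡ w * (x * (y * z))
  regroup′ = solve-∀
  choose-≥ : ∀ c → c ≤ K → e ^ c ≤ c ! * (m C c)
  choose-≥ c c≤K = ≤-trans (^-monoˡ-≤ c (m+n≤o⇒m≤o∸n e (+-monoʳ-≤ e c≤K))) (choose-lower m c)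
  step : ∀ c d → c + d ≤ K → e ^ (c + d) * (((c + d) C c) * W c d) ≤ (c + d) ! * ((m C c) * S c d)
  step c d c+d≤K = begin
    e ^ (c + d) * (((c + d) C c) * W c d)                   ≡⟨ cong (_* (((c + d) C c) * W c d)) (^-distribˡ-+-* e c d) ⟩
    e ^ c * e ^ d * (((c + d) C c) * W c d)                 ≡⟨ regroup′ ((c + d) C c) (e ^ c) (e ^ d) (W c d) ⟩
    ((c + d) C c) * (e ^ c * (e ^ d * W c d))               ≤⟨ *-monoʳ-≤ ((c + d) C c) (*-mono-≤ (choose-≥ c (≤-trans (m≤m+n c d) c+d≤K)) (sublistSum-inflate-≥ d e K bs _ (≤-trans (m≤n+m d c) c+d≤K))) ⟩
    ((c + d) C c) * ((c ! * (m C c)) * (d ! * S c d))       ≡⟨ regroup ((c + d) C c) (c !) (d !) (m C c) (S c d) ⟩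
    ((c + d) C c) * (c ! * d !) * ((m C c) * S c d)         ≡⟨ cong (_* ((m C c) * S c d)) (choose-split c d) ⟨
    (c + d) ! * ((m C c) * S c d)                           ∎

-- Occurrences of a pattern in an inflation

indicator : Bool → ℕ
indicator b = if b then 1 else 0

length-filter : ∀ {X : Set} (p : X → Bool) xs →
  length (filter (λ x → p x Bool.≟ true) xs) ≡ sum (map (indicator ∘ p) xs)
length-filter p [] = refl
length-filter p (x ∷ xs) with p x
... | true  = cong suc (length-filter p xs)
... | false = length-filter p xs

sum-map-1 : ∀ {X : Set} (xs : List X) → sum (map (λ _ → 1) xs) ≡ length xs
sum-map-1 []       = refl
sum-map-1 (x ∷ xs) = cong suc (sum-map-1 xs)

sum-map-cong : ∀ {X : Set} {f g : X → ℕ} {xs} → All (λ x → f x ≡ g x) xs → sum (map f xs) ≡ sum (map g xs)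
sum-map-cong []         = refl
sum-map-cong (eq ∷ eqs) = cong₂ _+_ eq (sum-map-cong eqs)

sum-increasing : ∀ {B : Set} k n (ℓ : Fin n → B) g →
  sum (map (g ∘ toList ∘ Vec.map ℓ) (increasing k n)) ≡ sublistSum k (tabulate ℓ) g
sum-increasing zero    n       ℓ g = ℕ.+-identityʳ _
sum-increasing (suc k) zero    ℓ g = refl
sum-increasing (suc k) (suc n) ℓ g = begin
  sum (map f (map (Vec.map suc) (increasing (suc k) n) ++ map (λ t → zero ∷ Vec.map suc t) (increasing k n)))
    ≡⟨ cong sum (map-++ f (map (Vec.map suc) (increasing (suc k) n)) _) ⟩
  sum (map f (map (Vec.map suc) (increasing (suc k) n)) ++ map f (map (λ t → zero ∷ Vec.map suc t) (increasing k n)))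
    ≡⟨ sum-++ (map f (map (Vec.map suc) (increasing (suc k) n))) _ ⟩
  sum (map f (map (Vec.map suc) (increasing (suc k) n))) + sum (map f (map (λ t → zero ∷ Vec.map suc t) (increasing k n)))
    ≡⟨ cong₂ (λ x y → sum x + sum y) (sym (map-∘ (increasing (suc k) n))) (sym (map-∘ (increasing k n))) ⟩
  sum (map (f ∘ Vec.map suc) (increasing (suc k) n)) + sum (map (λ t → f (zero ∷ Vec.map suc t)) (increasing k n))
    ≡⟨ cong₂ (λ x y → sum x + sum y)
         (map-cong (λ t → cong (g ∘ toList) (sym (Vec.map-∘ ℓ suc t))) (increasing (suc k) n))
         (map-cong (λ t → cong (g ∘ (ℓ zero ∷_) ∘ toList) (sym (Vec.map-∘ ℓ suc t))) (increasing k n)) ⟩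
  sum (map (g ∘ toList ∘ Vec.map (ℓ ∘ suc)) (increasing (suc k) n)) + sum (map (g ∘ (ℓ zero ∷_) ∘ toList ∘ Vec.map (ℓ ∘ suc)) (increasing k n))
    ≡⟨ cong₂ _+_ (sum-increasing (suc k) n (ℓ ∘ suc) g) (sum-increasing k n (ℓ ∘ suc) (g ∘ (ℓ zero ∷_))) ⟩
  sublistSum (suc k) (tabulate ℓ) g ∎
  where
  open ≡-Reasoning
  f = g ∘ toList ∘ Vec.map ℓ

Increasing : ∀ {k n} → Vec (Fin n) k → Set
Increasing a = ∀ i j → i Fin.< j → lookup a i Fin.< lookup a j

map-suc-Increasing : ∀ {k n} {a : Vec (Fin n) k} → Increasing a → Increasing (Vec.map suc a)
map-suc-Increasing {a = a} inc i j i<j rewrite Vec.lookup-map i Fin.suc a | Vec.lookup-map j Fin.suc a = s<s (inc i j i<j)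

zero∷-Increasing : ∀ {k n} {a : Vec (Fin n) k} → Increasing a → Increasing (zero ∷ Vec.map suc a)
zero∷-Increasing {a = a} inc zero    (suc j) i<j rewrite Vec.lookup-map j Fin.suc a = s≤s z≤n
zero∷-Increasing {a = a} inc (suc i) (suc j) i<j = map-suc-Increasing {a = a} inc i j (s<s⁻¹ i<j)

increasing-Increasing : ∀ k n → All Increasing (increasing k n)
increasing-Increasing zero    n       = (λ ()) ∷ []
increasing-Increasing (suc k) zero    = []
increasing-Increasing (suc k) (suc n) = All.++⁺
  (All.map⁺ (All.map (λ {a} → map-suc-Increasing {a = a}) (increasing-Increasing (suc k) n)))
  (All.map⁺ (All.map (λ {a} → zero∷-Increasing {a = a}) (increasing-Increasing k n)))

-- The value of an entry of the skeleton and whether its run increases.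
Block : Set
Block = ℕ × Bool

-- Compares the images of two points, the first of which lies further left;
-- distinct blocks have distinct values.
precedes : Block → Block → Bool
precedes (v , up) (w , _) = if v ≡ᵇ w then up else (v ℕ.<ᵇ w)

-- Each pair of positions is tested once, left one first, so that evaluation on the table stays
-- cheap; `allPairs` recovers the remaining comparisons of `occursAt`. The default `true` for
-- leftover entries does not matter for lists of equal length.
agreesHead : ℕ → Block → List ℕ → List Block → Bool
agreesHead v b (w ∷ ws) (c ∷ cs) = ⌊ precedes b c Bool.≟ (v ℕ.<ᵇ w) ⌋ ∧ agreesHead v b ws cs
agreesHead v b _        _        = true

agrees : List ℕ → List Block → Bool
agrees (v ∷ vs) (b ∷ bs) = agreesHead v b vs bs ∧ agrees vs bs
agrees _        _        = true

∧-true⁻ : ∀ {x y} → x ∧ y ≡ true → x ≡ true × y ≡ true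
∧-true⁻ {true} {true} _ = refl , refl

≟-true⁻ : ∀ {x y} → ⌊ x Bool.≟ y ⌋ ≡ true → x ≡ y
≟-true⁻ {true}  {true}  _ = refl
≟-true⁻ {false} {false} _ = refl

≟-true⁺ : ∀ {x y} → x ≡ y → ⌊ x Bool.≟ y ⌋ ≡ true
≟-true⁺ {true}  refl = refl
≟-true⁺ {false} refl = refl

true⇔⇒≡ : ∀ {x y} → (x ≡ true → y ≡ true) → (y ≡ true → x ≡ true) → x ≡ y
true⇔⇒≡ {true}  {y}     f g = sym (f refl)
true⇔⇒≡ {false} {true}  f g = g refl
true⇔⇒≡ {false} {false} f g = refl

agreesHead⁻ : ∀ {k} v b (vs : Vec ℕ k) (bs : Vec Block k) → agreesHead v b (toList vs) (toList bs) ≡ true →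
  ∀ j → precedes b (lookup bs j) ≡ (v ℕ.<ᵇ lookup vs j)
agreesHead⁻ v b (w ∷ ws) (c ∷ cs) eq zero    = ≟-true⁻ (proj₁ (∧-true⁻ eq))
agreesHead⁻ v b (w ∷ ws) (c ∷ cs) eq (suc j) = agreesHead⁻ v b ws cs (proj₂ (∧-true⁻ {⌊ precedes b c Bool.≟ (v ℕ.<ᵇ w) ⌋} eq)) j

agreesHead⁺ : ∀ {k} v b (vs : Vec ℕ k) (bs : Vec Block k) →
  (∀ j → precedes b (lookup bs j) ≡ (v ℕ.<ᵇ lookup vs j)) → agreesHead v b (toList vs) (toList bs) ≡ true
agreesHead⁺ v b []       []       eq = refl
agreesHead⁺ v b (w ∷ ws) (c ∷ cs) eq = cong₂ _∧_ (≟-true⁺ (eq zero)) (agreesHead⁺ v b ws cs (eq ∘ suc))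

agrees⁻ : ∀ {k} (vs : Vec ℕ k) (bs : Vec Block k) → agrees (toList vs) (toList bs) ≡ true →
  ∀ i j → i Fin.< j → precedes (lookup bs i) (lookup bs j) ≡ (lookup vs i ℕ.<ᵇ lookup vs j)
agrees⁻ (v ∷ vs) (b ∷ bs) eq zero    (suc j) i<j = agreesHead⁻ v b vs bs (proj₁ (∧-true⁻ eq)) j
agrees⁻ (v ∷ vs) (b ∷ bs) eq (suc i) (suc j) i<j =
  agrees⁻ vs bs (proj₂ (∧-true⁻ {agreesHead v b (toList vs) (toList bs)} eq)) i j (s<s⁻¹ i<j)

agrees⁺ : ∀ {k} (vs : Vec ℕ k) (bs : Vec Block k) →
  (∀ i j → i Fin.< j → precedes (lookup bs i) (lookup bs j) ≡ (lookup vs i ℕ.<ᵇ lookup vs j)) →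
  agrees (toList vs) (toList bs) ≡ true
agrees⁺ []       []       eq = refl
agrees⁺ (v ∷ vs) (b ∷ bs) eq = cong₂ _∧_
  (agreesHead⁺ v b vs bs (λ j → eq zero (suc j) (s≤s z≤n)))
  (agrees⁺ vs bs (λ i j i<j → eq (suc i) (suc j) (s<s i<j)))

allᵇ⁻ : ∀ {k} (p : Fin k → Bool) → allᵇ p ≡ true → ∀ i → p i ≡ true
allᵇ⁻ p eq zero    = proj₁ (∧-true⁻ eq)
allᵇ⁻ p eq (suc i) = allᵇ⁻ (p ∘ suc) (proj₂ (∧-true⁻ {p zero} eq)) i

allᵇ⁺ : ∀ {k} (p : Fin k → Bool) → (∀ i → p i ≡ true) → allᵇ p ≡ true
allᵇ⁺ {zero}  p eq = refl
allᵇ⁺ {suc k} p eq = cong₂ _∧_ (eq zero) (allᵇ⁺ (p ∘ suc) (eq ∘ suc))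

<ᵇ-toℕ : ∀ {n} (i j : Fin n) → (i <ᵇ j) ≡ (toℕ i ℕ.<ᵇ toℕ j)
<ᵇ-toℕ i j = isYes≗does (i Fin.<? j)

<ᵇ-true : ∀ {m n} → m ℕ.< n → (m ℕ.<ᵇ n) ≡ true
<ᵇ-true m<n = Equivalence.to T-≡ (ℕ.<⇒<ᵇ m<n)

<ᵇ-false : ∀ {m n} → ¬ m ℕ.< n → (m ℕ.<ᵇ n) ≡ false
<ᵇ-false m≮n = ¬-not (m≮n ∘ ℕ.<ᵇ⇒< _ _ ∘ Equivalence.from T-≡)

<ᵇ-irrefl : ∀ m → (m ℕ.<ᵇ m) ≡ false
<ᵇ-irrefl m = <ᵇ-false {m} {m} (ℕ.<-irrefl refl)

<ᵇ-flip : ∀ {m n} → m ≢ n → (m ℕ.<ᵇ n) ≡ not (n ℕ.<ᵇ m)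
<ᵇ-flip {m} {n} m≢n with ℕ.<-cmp m n
... | tri< m<n _ n≮m = trans (<ᵇ-true m<n) (cong not (sym (<ᵇ-false n≮m)))
... | tri≈ _ m≡n _   = contradiction m≡n m≢n
... | tri> m≮n _ n<m = trans (<ᵇ-false m≮n) (cong not (sym (<ᵇ-true n<m)))

injective : ∀ {n} (π : Permutation′ n) {i j} → π ⟨$⟩ʳ i ≡ π ⟨$⟩ʳ j → i ≡ j
injective π = Injection.injective (↔⇒↣ π)

word : ∀ {k} → Permutation′ k → Vec ℕ k
word σ = Vec.tabulate (toℕ ∘ (σ ⟨$⟩ʳ_))

module _ {k n} (σ : Permutation′ k) (π : Permutation′ n) (a : Vec (Fin n) k) (a-inc : Increasing a)
         (ℓ : Fin n → Block)
         (ℓ-precedes : ∀ {p q} → p Fin.< q → precedes (ℓ p) (ℓ q) ≡ (toℕ (π ⟨$⟩ʳ p) ℕ.<ᵇ toℕ (π ⟨$⟩ʳ q))) where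

  private
    s : Fin k → ℕ
    s i = toℕ (π ⟨$⟩ʳ lookup a i)

    w : Fin k → ℕ
    w i = toℕ (σ ⟨$⟩ʳ i)

    precedes-s : ∀ {i j} → i Fin.< j → precedes (lookup (Vec.map ℓ a) i) (lookup (Vec.map ℓ a) j) ≡ (s i ℕ.<ᵇ s j)
    precedes-s {i} {j} i<j rewrite Vec.lookup-map i ℓ a | Vec.lookup-map j ℓ a = ℓ-precedes (a-inc i j i<j)

    s-distinct : ∀ {i j} → i Fin.< j → s j ≢ s i
    s-distinct {i} {j} i<j eq = Fin.<⇒≢ (a-inc i j i<j) (sym (injective π (Fin.toℕ-injective eq)))

    w-distinct : ∀ {i j} → i Fin.< j → w i ≢ w j
    w-distinct i<j eq = Fin.<⇒≢ i<j (injective σ (Fin.toℕ-injective eq))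

    -- Values at distinct positions differ, on both sides, so the comparison for `j < i` is the
    -- negation of the one for the swapped pair; on the diagonal both are false.
    allPairs : (∀ i j → i Fin.< j → (s i ℕ.<ᵇ s j) ≡ (w i ℕ.<ᵇ w j)) → ∀ i j → (s i ℕ.<ᵇ s j) ≡ (w i ℕ.<ᵇ w j)
    allPairs eq i j with Fin.<-cmp i j
    ... | tri< i<j _ _  = eq i j i<j
    ... | tri≈ _ refl _ = trans (<ᵇ-irrefl (s i)) (sym (<ᵇ-irrefl (w i)))
    ... | tri> _ _ j<i  = trans (<ᵇ-flip (s-distinct j<i))
                            (trans (cong not (eq j i j<i)) (sym (<ᵇ-flip (w-distinct j<i ∘ sym))))

    toℕ-pair : ∀ i j → ((π ⟨$⟩ʳ lookup a i) <ᵇ (π ⟨$⟩ʳ lookup a j)) ≡ ((σ ⟨$⟩ʳ i) <ᵇ (σ ⟨$⟩ʳ j)) →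
               (s i ℕ.<ᵇ s j) ≡ (w i ℕ.<ᵇ w j)
    toℕ-pair i j eq = trans (sym (<ᵇ-toℕ (π ⟨$⟩ʳ lookup a i) (π ⟨$⟩ʳ lookup a j))) (trans eq (<ᵇ-toℕ (σ ⟨$⟩ʳ i) (σ ⟨$⟩ʳ j)))

    toℕ-pair⁻ : ∀ i j → (s i ℕ.<ᵇ s j) ≡ (w i ℕ.<ᵇ w j) →
               ((π ⟨$⟩ʳ lookup a i) <ᵇ (π ⟨$⟩ʳ lookup a j)) ≡ ((σ ⟨$⟩ʳ i) <ᵇ (σ ⟨$⟩ʳ j))
    toℕ-pair⁻ i j eq = trans (<ᵇ-toℕ (π ⟨$⟩ʳ lookup a i) (π ⟨$⟩ʳ lookup a j)) (trans eq (sym (<ᵇ-toℕ (σ ⟨$⟩ʳ i) (σ ⟨$⟩ʳ j))))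

    lookup-word : ∀ i → lookup (word σ) i ≡ w i
    lookup-word i = Vec.lookup∘tabulate w i

  -- The labelling `ℓ` enters only through the fact that `precedes` recovers the order of values
  -- from two labels. For inflations this is `blockOf-precedes`.
  occursAt≡agrees : occursAt σ π a ≡ agrees (toList (word σ)) (toList (Vec.map ℓ a))
  occursAt≡agrees = true⇔⇒≡
    (λ occ → agrees⁺ (word σ) (Vec.map ℓ a) λ i j i<j → trans (precedes-s i<j)
       (trans (toℕ-pair i j (≟-true⁻ (allᵇ⁻ _ (allᵇ⁻ _ occ i) j)))
              (sym (cong₂ ℕ._<ᵇ_ (lookup-word i) (lookup-word j)))))
    (λ agr → allᵇ⁺ _ λ i → allᵇ⁺ _ λ j → ≟-true⁺ (toℕ-pair⁻ i j (allPairs (λ i j i<j →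
       trans (sym (precedes-s i<j)) (trans (agrees⁻ (word σ) (Vec.map ℓ a) agr i j i<j)
         (cong₂ ℕ._<ᵇ_ (lookup-word i) (lookup-word j)))) i j)))

-- The inflation as a permutation of `Fin (n * m)`.

orient : ∀ {m} → Bool → Fin m → Fin m
orient true  i = i
orient false i = opposite i

orient-involutive : ∀ {m} up (i : Fin m) → orient up (orient up i) ≡ i
orient-involutive true  i = refl
orient-involutive false i = Fin.opposite-involutive i

module Inflation {n} (π : Permutation′ n) (up : Fin n → Bool) (m : ℕ) where

  private
    to from : Fin n × Fin m → Fin (n * m)
    to   (a , i) = combine (π ⟨$⟩ʳ a) (orient (up a) i)
    from (b , i) = combine (π ⟨$⟩ˡ b) (orient (up (π ⟨$⟩ˡ b)) i)

    combine-remQuot′ : ∀ p → combine (proj₁ (remQuot {n} m p)) (proj₂ (remQuot {n} m p)) ≡ p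
    combine-remQuot′ = Fin.combine-remQuot {n} m

    to-from : ∀ q → to (remQuot m (from (remQuot m q))) ≡ q
    to-from q = begin
      to (remQuot m (combine a (orient (up a) i)))           ≡⟨ cong to (Fin.remQuot-combine a (orient (up a) i)) ⟩
      combine (π ⟨$⟩ʳ a) (orient (up a) (orient (up a) i))   ≡⟨ cong₂ combine (inverseʳ π) (orient-involutive (up a) i) ⟩
      combine b i                                            ≡⟨ combine-remQuot′ q ⟩
      q                                                      ∎
      where
      open ≡-Reasoning
      b = proj₁ (remQuot {n} m q)
      i = proj₂ (remQuot {n} m q)
      a = π ⟨$⟩ˡ b

    from-to : ∀ p → from (remQuot m (to (remQuot m p))) ≡ p
    from-to p = begin
      from (remQuot m (combine (π ⟨$⟩ʳ a) (orient (up a) i)))  ≡⟨ cong from (Fin.remQuot-combine (π ⟨$⟩ʳ a) (orient (up a) i)) ⟩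
      combine (π ⟨$⟩ˡ (π ⟨$⟩ʳ a)) (orient (up (π ⟨$⟩ˡ (π ⟨$⟩ʳ a))) (orient (up a) i))
        ≡⟨ cong (λ c → combine c (orient (up c) (orient (up a) i))) (inverseˡ π) ⟩
      combine a (orient (up a) (orient (up a) i))              ≡⟨ cong (combine a) (orient-involutive (up a) i) ⟩
      combine a i                                              ≡⟨ combine-remQuot′ p ⟩
      p                                                        ∎
      where
      open ≡-Reasoning
      a = proj₁ (remQuot {n} m p)
      i = proj₂ (remQuot {n} m p)

  -- Positions and values are both pairs in lexicographic order, block first and place in the run
  -- second. Since `orient` is an involution, the inverse has the same shape.
  inflation : Permutation′ (n * m)
  inflation = permutation (to ∘ remQuot m) (from ∘ remQuot m) to-from from-to

  block : Fin n → Block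
  block a = toℕ (π ⟨$⟩ʳ a) , up a

  blockOf : Fin (n * m) → Block
  blockOf p = block (quotient m p)

  private
    combine-<ʳ : ∀ {n} (a : Fin n) {i j : Fin m} → i Fin.< j → combine a i Fin.< combine a j
    combine-<ʳ a {i} {j} i<j = subst₂ ℕ._<_ (sym (Fin.toℕ-combine a i)) (sym (Fin.toℕ-combine a j)) (ℕ.+-monoʳ-< (m * toℕ a) i<j)

    combine-<ʳ⁻ : ∀ {n} (a : Fin n) {i j : Fin m} → combine a i Fin.< combine a j → i Fin.< j
    combine-<ʳ⁻ a {i} {j} lt = ℕ.+-cancelˡ-< (m * toℕ a) _ _ (subst₂ ℕ._<_ (Fin.toℕ-combine a i) (Fin.toℕ-combine a j) lt)

    opposite-< : ∀ {i j : Fin m} → i Fin.< j → opposite j Fin.< opposite i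
    opposite-< {i} {j} i<j = subst₂ ℕ._<_ (sym (Fin.opposite-prop j)) (sym (Fin.opposite-prop i))
      (ℕ.∸-monoʳ-< (s≤s i<j) (Fin.toℕ<n j))

    ≡ᵇ-refl : ∀ v → (v ≡ᵇ v) ≡ true
    ≡ᵇ-refl v = Equivalence.to T-≡ (ℕ.≡⇒≡ᵇ v v refl)

    ≡ᵇ-false : ∀ {v w} → v ≢ w → (v ≡ᵇ w) ≡ false
    ≡ᵇ-false v≢w = ¬-not (v≢w ∘ ℕ.≡ᵇ⇒≡ _ _ ∘ Equivalence.from T-≡)

    precedes-same : ∀ a {i j : Fin m} → i Fin.< j →
      precedes (block a) (block a) ≡ (toℕ (to (a , i)) ℕ.<ᵇ toℕ (to (a , j)))
    precedes-same a i<j rewrite ≡ᵇ-refl (toℕ (π ⟨$⟩ʳ a)) with up a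
    ... | true  = sym (<ᵇ-true (combine-<ʳ (π ⟨$⟩ʳ a) i<j))
    ... | false = sym (<ᵇ-false (ℕ.<⇒≯ (combine-<ʳ (π ⟨$⟩ʳ a) (opposite-< i<j))))

    -- The code `combine` is lexicographic, so between different blocks the places `i` and `j` have
    -- no influence.
    precedes-distinct : ∀ {a b} → a ≢ b → ∀ i j →
      precedes (block a) (block b) ≡ (toℕ (to (a , i)) ℕ.<ᵇ toℕ (to (b , j)))
    precedes-distinct {a} {b} a≢b i j
      rewrite ≡ᵇ-false (a≢b ∘ injective π ∘ Fin.toℕ-injective {i = π ⟨$⟩ʳ a} {j = π ⟨$⟩ʳ b})
      with Fin.<-cmp (π ⟨$⟩ʳ a) (π ⟨$⟩ʳ b)
    ... | tri< lt _ _ = trans (<ᵇ-true lt) (sym (<ᵇ-true (Fin.combine-monoˡ-< _ _ lt)))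
    ... | tri≈ _ eq _ = contradiction (injective π eq) a≢b
    ... | tri> ngt _ gt = trans (<ᵇ-false ngt) (sym (<ᵇ-false (ℕ.<⇒≯ (Fin.combine-monoˡ-< _ _ gt))))

    precedes-pairs : ∀ a i b j → combine a i Fin.< combine b j →
      precedes (block a) (block b) ≡ (toℕ (to (a , i)) ℕ.<ᵇ toℕ (to (b , j)))
    precedes-pairs a i b j lt with a Fin.≟ b
    ... | yes refl = precedes-same a (combine-<ʳ⁻ a lt)
    ... | no a≢b   = precedes-distinct a≢b i j

  blockOf-precedes : ∀ {p q} → p Fin.< q →
    precedes (blockOf p) (blockOf q) ≡ (toℕ (inflation ⟨$⟩ʳ p) ℕ.<ᵇ toℕ (inflation ⟨$⟩ʳ q))
  blockOf-precedes {p} {q} p<q = precedes-pairs _ _ _ _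
    (subst₂ Fin._<_ (sym (combine-remQuot′ p)) (sym (combine-remQuot′ q)) p<q)

-- The blocks of an inflation, read position by position.

tabulate-+ : ∀ {B : Set} m {n} (f : Fin (m + n) → B) → tabulate f ≡ tabulate (f ∘ (_↑ˡ n)) ++ tabulate (f ∘ (m ↑ʳ_))
tabulate-+ zero    f = refl
tabulate-+ (suc m) f = cong (f zero ∷_) (tabulate-+ m (f ∘ suc))

tabulate-const : ∀ {B : Set} m (b : B) → tabulate {n = m} (λ _ → b) ≡ replicate m b
tabulate-const zero    b = refl
tabulate-const (suc m) b = cong (b ∷_) (tabulate-const m b)

quotient-↑ʳ : ∀ {n} m (p : Fin (n * m)) → quotient {suc n} m (m ↑ʳ p) ≡ suc (quotient m p)
quotient-↑ʳ {n} m p = begin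
  quotient {suc n} m (m ↑ʳ p)                          ≡⟨ cong (λ p → quotient {suc n} m (m ↑ʳ p)) (Fin.combine-remQuot {n} m p) ⟨
  quotient {suc n} m (combine (suc a) i)               ≡⟨ cong proj₁ (Fin.remQuot-combine (suc a) i) ⟩
  suc a                                                ∎
  where
  open ≡-Reasoning
  a = proj₁ (remQuot {n} m p)
  i = proj₂ (remQuot {n} m p)

tabulate-quotient : ∀ {B : Set} n m (β : Fin n → B) → tabulate {n = n * m} (β ∘ quotient m) ≡ inflate m (tabulate β)
tabulate-quotient zero    m β = refl
tabulate-quotient (suc n) m β = begin
  tabulate (β ∘ quotient {suc n} m)
    ≡⟨ tabulate-+ m (β ∘ quotient {suc n} m) ⟩
  tabulate (β ∘ quotient {suc n} m ∘ (_↑ˡ (n * m))) ++ tabulate (β ∘ quotient {suc n} m ∘ (m ↑ʳ_))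
    ≡⟨ cong₂ _++_ (tabulate-cong (λ i → cong (β ∘ proj₁) (Fin.remQuot-combine {suc n} zero i)))
                  (tabulate-cong (λ p → cong β (quotient-↑ʳ m p))) ⟩
  tabulate {n = m} (λ _ → β zero) ++ tabulate {n = n * m} (β ∘ Fin.suc ∘ quotient m)
    ≡⟨ cong₂ _++_ (tabulate-const m (β zero)) (tabulate-quotient n m (β ∘ suc)) ⟩
  inflate m (tabulate β) ∎
  where open ≡-Reasoning

occurrences : ∀ {k n} → Permutation′ k → Permutation′ n → ℕ
occurrences {k} {n} σ π = length (filter (λ a → occursAt σ π a Bool.≟ true) (increasing k n))

module _ {k n} (σ : Permutation′ k) (π : Permutation′ n) (up : Fin n → Bool) (m : ℕ) where
  open Inflation π up m

  count-inflation : occurrences σ inflation ≡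
    sublistSum k (inflate m (tabulate block)) (indicator ∘ agrees (toList (word σ)))
  count-inflation = begin
    occurrences σ inflation
      ≡⟨ length-filter (occursAt σ inflation) (increasing k (n * m)) ⟩
    sum (map (indicator ∘ occursAt σ inflation) (increasing k (n * m)))
      ≡⟨ sum-map-cong (All.map (λ {a} inc → cong indicator (occursAt≡agrees σ inflation a inc blockOf blockOf-precedes))
           (increasing-Increasing k (n * m))) ⟩
    sum (map (indicator ∘ agrees (toList (word σ)) ∘ toList ∘ Vec.map blockOf) (increasing k (n * m)))
      ≡⟨ sum-increasing k (n * m) blockOf _ ⟩
    sublistSum k (tabulate blockOf) (indicator ∘ agrees (toList (word σ)))
      ≡⟨ cong (λ L → sublistSum k L (indicator ∘ agrees (toList (word σ)))) (tabulate-quotient n m block) ⟩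
    sublistSum k (inflate m (tabulate block)) (indicator ∘ agrees (toList (word σ))) ∎
    where open ≡-Reasoning

  -- Constant weight 1 puts the denominator of the density into the same form as its numerator, so
  -- one pair of bounds serves both.
  size-inflation : length (increasing k (n * m)) ≡ sublistSum k (inflate m (tabulate block)) (λ _ → 1)
  size-inflation = begin
    length (increasing k (n * m))                          ≡⟨ sum-map-1 (increasing k (n * m)) ⟨
    sum (map (λ _ → 1) (increasing k (n * m)))             ≡⟨ sum-increasing k (n * m) blockOf (λ _ → 1) ⟩
    sublistSum k (tabulate blockOf) (λ _ → 1)              ≡⟨ cong (λ L → sublistSum k L (λ _ → 1)) (tabulate-quotient n m block) ⟩
    sublistSum k (inflate m (tabulate block)) (λ _ → 1)    ∎
    where open ≡-Reasoning

-- Limit densities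

-- Values of `frac` are in lowest terms; equality becomes cross-multiplication only on the
-- unnormalised fractions behind them.
frac-≡⁺ : ∀ a b c d → a * suc d ≡ c * suc b → frac a (suc b) ≡ frac c (suc d)
frac-≡⁺ a b c d eq = ℚ.fromℚᵘ-cong {mkℚᵘ (ℤ.+ a) b} {mkℚᵘ (ℤ.+ c) d} (*≡* (begin
  ℤ.+ a ℤ.* ℤ.+ suc d   ≡⟨ ℤ.pos-* a (suc d) ⟨
  ℤ.+ (a * suc d)     ≡⟨ cong ℤ.+_ eq ⟩
  ℤ.+ (c * suc b)     ≡⟨ ℤ.pos-* c (suc b) ⟩
  ℤ.+ c ℤ.* ℤ.+ suc b   ∎))
  where open ≡-Reasoning

frac-≡⁻ : ∀ a b c d → frac a (suc b) ≡ frac c (suc d) → a * suc d ≡ c * suc b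
frac-≡⁻ a b c d eq with ℚ.fromℚᵘ-injective {mkℚᵘ (ℤ.+ a) b} {mkℚᵘ (ℤ.+ c) d} eq
... | *≡* eq′ = ℤ.+-injective (trans (ℤ.pos-* a (suc d)) (trans eq′ (sym (ℤ.pos-* c (suc b)))))

∣⊖∣≡∣-∣ : ∀ m n → ℤ.∣ m ⊖ n ∣ ≡ ∣ m - n ∣
∣⊖∣≡∣-∣ m n with ≤-total m n
... | inj₁ m≤n = trans (ℤ.∣⊖∣-≤ m≤n) (sym (m≤n⇒∣m-n∣≡n∸m m≤n))
... | inj₂ n≤m = trans (ℤ.∣m⊖n∣≡∣n⊖m∣ m n) (trans (ℤ.∣⊖∣-≤ n≤m) (sym (trans (∣-∣-comm m n) (m≤n⇒∣m-n∣≡n∸m n≤m))))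

∣frac-frac∣<ε : ∀ a b c d x y .(cop : Coprime (suc x) (suc y)) → ∣ a * suc d - c * suc b ∣ * suc y < suc x * (suc b * suc d) →
  ℚ.∣ frac a (suc b) ℚ.- frac c (suc d) ∣ ℚ.< mkℚ +[1+ x ] y cop
∣frac-frac∣<ε a b c d x y _ lt = ℚ.toℚᵘ-cancel-< (ℚᵘ.<-respˡ-≃ (ℚᵘ.≃-sym unnormalise) (ℚᵘ.*<* (begin-strict
  ℤ.+ ℤ.∣ num ∣ ℤ.* ℤ.+ suc y                      ≡⟨ cong (λ z → ℤ.+ z ℤ.* ℤ.+ suc y) num-abs ⟩
  ℤ.+ ∣ a * suc d - c * suc b ∣ ℤ.* ℤ.+ suc y      ≡⟨ ℤ.pos-* ∣ a * suc d - c * suc b ∣ (suc y) ⟨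
  ℤ.+ (∣ a * suc d - c * suc b ∣ * suc y)        <⟨ ℤ.+<+ lt ⟩
  ℤ.+ (suc x * (suc b * suc d))                  ≡⟨ ℤ.pos-* (suc x) (suc b * suc d) ⟩
  ℤ.+ suc x ℤ.* ℤ.+ (suc b * suc d)                ∎)))
  where
  open ℤ.≤-Reasoning
  num = ℤ.+ a ℤ.* ℤ.+ suc d ℤ.+ (ℤ.- ℤ.+ c) ℤ.* ℤ.+ suc b
  num-abs : ℤ.∣ num ∣ ≡ ∣ a * suc d - c * suc b ∣
  num-abs = trans (cong ℤ.∣_∣ (trans
    (cong₂ ℤ._+_ (sym (ℤ.pos-* a (suc d)))
       (trans (sym (ℤ.neg-distribˡ-* (ℤ.+ c) (ℤ.+ suc b))) (cong ℤ.-_ (sym (ℤ.pos-* c (suc b))))))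
    (ℤ.m-n≡m⊖n (a * suc d) (c * suc b)))) (∣⊖∣≡∣-∣ (a * suc d) (c * suc b))
  u v : ℚᵘ
  u = mkℚᵘ (ℤ.+ a) b
  v = mkℚᵘ (ℤ.+ c) d
  p = frac a (suc b)
  q = frac c (suc d)
  unnormalise : toℚᵘ ℚ.∣ p ℚ.- q ∣ ℚᵘ.≃ ℚᵘ.∣ u ℚᵘ.- v ∣
  unnormalise = ℚᵘ.≃-trans (ℚ.toℚᵘ-homo-∣-∣ (p ℚ.- q)) (ℚᵘ.∣-∣-cong (ℚᵘ.≃-trans (ℚ.toℚᵘ-homo-+ p (ℚ.- q))
    (ℚᵘ.+-cong (ℚ.toℚᵘ-fromℚᵘ u) (ℚᵘ.≃-trans (ℚ.toℚᵘ-homo‿- q) (ℚᵘ.-‿cong (ℚ.toℚᵘ-fromℚᵘ v))))))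

-- With denominators cleared, the last hypothesis bounds the distance of `N m / T m` from `P / Q` by
-- κ / (m + 1).
frac-⟶ : ∀ (N T : ℕ → ℕ) P Q κ → 0 < Q → (∀ m → 0 < T m) →
  (∀ m → ∣ N m * Q - P * T m ∣ * suc m ≤ κ * (T m * Q)) →
  (λ m → frac (N m) (T m)) ⟶ frac P Q
-- Here ε = (x + 1) / (y + 1) is at least 1 / (y + 1), and m ≥ κ (y + 1) already brings κ / (m + 1)
-- below that.
frac-⟶ N T P (suc Q) κ _ T>0 bound (mkℚ +[1+ x ] y cop) _ = κ * suc y , λ m m≥ → close (N m) (T m) m (T>0 m) (bound m) m≥
  where
  open ≤-Reasoning
  swap-* : ∀ a b c → a * (b * c) ≡ b * (a * c)
  swap-* = solve-∀
  close : ∀ n t m → 0 < t → ∣ n * suc Q - P * t ∣ * suc m ≤ κ * (t * suc Q) → κ * suc y ≤ m →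
          ℚ.∣ frac n t ℚ.- frac P (suc Q) ∣ ℚ.< mkℚ +[1+ x ] y cop
  close n (suc t) m _ bd κ≤m = ∣frac-frac∣<ε n t P Q x y cop (<-≤-trans (≰⇒> too-far) (m≤n*m Y (suc x)))
    where
    X = ∣ n * suc Q - P * suc t ∣
    Y = suc t * suc Q
    too-far : ¬ Y ≤ X * suc y
    -- Otherwise the bound gives X (m + 1) ≤ X m, so `X` vanishes and the positive number `Y` would
    -- be at most 0.
    too-far Y≤ = contradiction Y≤ (subst (λ z → ¬ Y ≤ z * suc y) (sym X≡0) λ ())
      where
      X≡0 : X ≡ 0
      X≡0 = n≤0⇒n≡0 (+-cancelʳ-≤ (X * m) X 0 (begin
        X + X * m          ≡⟨ *-suc X m ⟨
        X * suc m          ≤⟨ bd ⟩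
        κ * Y              ≤⟨ *-monoʳ-≤ κ Y≤ ⟩
        κ * (X * suc y)    ≡⟨ swap-* κ X (suc y) ⟩
        X * (κ * suc y)    ≤⟨ *-monoʳ-≤ X κ≤m ⟩
        X * m              ∎))
frac-⟶ N T P (suc Q) κ _ T>0 bound (mkℚ (ℤ.+ 0) y _) (ℚ.*<* (ℤ.+<+ ()))
frac-⟶ N T P (suc Q) κ _ T>0 bound (mkℚ -[1+ x ] y _) (ℚ.*<* ())

-- With ε half the distance of the limits, a common late index violates the triangle inequality. The
-- doubly negated form feeds directly into a refutation.
⟶-unique : ∀ {x L M} → x ⟶ L → x ⟶ M → ¬ L ≢ M
⟶-unique {x} {L} {M} x⟶L x⟶M L≢M = ℚ.<-irrefl refl (begin-strict
  ℚ.∣ L ℚ.- M ∣                                 ≡⟨ cong ℚ.∣_∣ (split L (x m) M) ⟩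
  ℚ.∣ (ℚ.- (x m ℚ.- L)) ℚ.+ (x m ℚ.- M) ∣       ≤⟨ ℚ.∣p+q∣≤∣p∣+∣q∣ (ℚ.- (x m ℚ.- L)) (x m ℚ.- M) ⟩
  ℚ.∣ ℚ.- (x m ℚ.- L) ∣ ℚ.+ ℚ.∣ x m ℚ.- M ∣     ≡⟨ cong (ℚ._+ ℚ.∣ x m ℚ.- M ∣) (ℚ.∣-p∣≡∣p∣ (x m ℚ.- L)) ⟩
  ℚ.∣ x m ℚ.- L ∣ ℚ.+ ℚ.∣ x m ℚ.- M ∣           <⟨ ℚ.+-mono-< (proj₂ near-L m (m≤m⊔n _ _)) (proj₂ near-M m (m≤n⊔m (proj₁ near-L) _)) ⟩
  ε ℚ.+ ε                                       ≡⟨ halves ⟩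
  ℚ.∣ L ℚ.- M ∣                                 ∎)
  where
  open ℚ.≤-Reasoning
  ε = ½ ℚ.* ℚ.∣ L ℚ.- M ∣
  halves : ε ℚ.+ ε ≡ ℚ.∣ L ℚ.- M ∣
  halves = trans (sym (ℚ.*-distribʳ-+ ℚ.∣ L ℚ.- M ∣ ½ ½)) (ℚ.*-identityˡ ℚ.∣ L ℚ.- M ∣)
  split : ∀ L y M → L ℚ.- M ≡ (ℚ.- (y ℚ.- L)) ℚ.+ (y ℚ.- M)
  split = +-*-Solver.solve 3 (λ L y M → L :- M := (:- (y :- L)) :+ (y :- M)) refl
    where open +-*-Solver
  L-M≢0 : ℚ.∣ L ℚ.- M ∣ ≢ 0ℚ
  L-M≢0 eq = L≢M (trans (trans (cancel L M) (cong (ℚ._+ M) (ℚ.∣p∣≡0⇒p≡0 (L ℚ.- M) eq))) (ℚ.+-identityˡ M))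
    where
    cancel : ∀ L M → L ≡ (L ℚ.- M) ℚ.+ M
    cancel = +-*-Solver.solve 2 (λ L M → L := (L :- M) :+ M) refl
      where open +-*-Solver
  ε>0 : 0ℚ ℚ.< ε
  ε>0 = subst (ℚ._< ε) (ℚ.*-zeroʳ ½) (ℚ.*-monoʳ-<-pos ½ (ℚ.≰⇒> λ ≤0 → L-M≢0 (ℚ.≤-antisym ≤0 (ℚ.0≤∣p∣ (L ℚ.- M)))))
  near-L = x⟶L ε ε>0
  near-M = x⟶M ε ε>0
  m = proj₁ near-L ⊔ proj₁ near-M

∣-∣-≤ : ∀ a b c → a ≤ b + c → b ≤ a + c → ∣ a - b ∣ ≤ c
∣-∣-≤ a b c a≤ b≤ with ≤-total a b
... | inj₁ a≤b = subst (_≤ c) (sym (m≤n⇒∣m-n∣≡n∸m a≤b)) (m≤n+o⇒m∸n≤o b a b≤)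
... | inj₂ b≤a = subst (_≤ c) (sym (trans (∣-∣-comm a b) (m≤n⇒∣m-n∣≡n∸m b≤a))) (m≤n+o⇒m∸n≤o a b a≤)

-- (1 + K / e)ᵏ ≤ 1 + growth K k / e for e ≥ 1.
growth : ℕ → ℕ → ℕ
growth K zero    = 0
growth K (suc k) = growth K k + K + growth K k * K

^-growth : ∀ K k e .{{_ : NonZero e}} → (e + K) ^ k * e ≤ e ^ k * (e + growth K k)
^-growth K zero    e = ≤-reflexive (cong (1 *_) (sym (+-identityʳ e)))
^-growth K (suc k) e = begin
  (e + K) * (e + K) ^ k * e                             ≡⟨ *-assoc (e + K) ((e + K) ^ k) e ⟩
  (e + K) * ((e + K) ^ k * e)                           ≤⟨ *-monoʳ-≤ (e + K) (^-growth K k e) ⟩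
  (e + K) * (e ^ k * (e + G))                           ≡⟨ expand e K (e ^ k) G ⟩
  -- The second-order term G K / e² of (1 + K / e)(1 + G / e) is replaced by G K / e, using e ≥ 1.
  e ^ k * (e * (e + G + K) + G * K)                     ≤⟨ *-monoʳ-≤ (e ^ k) (+-monoʳ-≤ (e * (e + G + K)) (m≤n*m (G * K) e)) ⟩
  e ^ k * (e * (e + G + K) + e * (G * K))               ≡⟨ collect e K (e ^ k) G ⟩
  e * e ^ k * (e + (G + K + G * K))                     ∎
  where
  open ≤-Reasoning
  G = growth K k
  expand : ∀ e K p G → (e + K) * (p * (e + G)) ≡ p * (e * (e + G + K) + G * K)
  expand = solve-∀
  collect : ∀ e K p G → p * (e * (e + G + K) + e * (G * K)) ≡ e * p * (e + (G + K + G * K))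
  collect = solve-∀

-- The four bounds place `N / T` between `P / Q` divided by and multiplied by (1 + K / e)ᵏ, and
-- `^-growth` turns that factor into an error of order 1 / e. All denominators are multiplied out.
cross-bound : ∀ K k e .{{_ : NonZero e}} N T P Q →
  k ! * N ≤ (e + K) ^ k * P → e ^ k * P ≤ k ! * N →
  k ! * T ≤ (e + K) ^ k * Q → e ^ k * Q ≤ k ! * T →
  ∣ N * Q - P * T ∣ * e ≤ growth K k * P * T
cross-bound K k e N T P Q N≤ ≤N T≤ ≤T =
  subst (_≤ G * P * T) (sym (*-distribʳ-∣-∣ e (N * Q) (P * T)))
    (∣-∣-≤ (N * Q * e) (P * T * e) (G * P * T) above below)
  where
  open ≤-Reasoning
  G = growth K k
  F = k !
  instance _ = k !≢0
  r₁ : ∀ f n q e → f * (n * q * e) ≡ (f * n) * (q * e)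
  r₁ = solve-∀
  r₂ : ∀ y p q e → (y * p) * (q * e) ≡ (y * e) * (p * q)
  r₂ = solve-∀
  r₃ : ∀ z e g p q → (z * (e + g)) * (p * q) ≡ (z * q) * (p * e + g * p)
  r₃ = solve-∀
  r₄ : ∀ f t p e g → (f * t) * (p * e + g * p) ≡ f * (p * t * e + g * p * t)
  r₄ = solve-∀
  r₅ : ∀ f p t e → f * (p * t * e) ≡ (f * t) * (p * e)
  r₅ = solve-∀
  r₆ : ∀ z e g p q → (z * (e + g)) * (p * q) ≡ (z * p) * (q * e) + (z * q) * (g * p)
  r₆ = solve-∀
  r₇ : ∀ f n q e t g p → (f * n) * (q * e) + (f * t) * (g * p) ≡ f * (n * q * e + g * p * t)
  r₇ = solve-∀
  r₈ : ∀ y q p e → (y * q) * (p * e) ≡ (y * e) * (p * q)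
  r₈ = solve-∀
  above : N * Q * e ≤ P * T * e + G * P * T
  above = *-cancelˡ-≤ F (begin
    F * (N * Q * e)                          ≡⟨ r₁ F N Q e ⟩
    (F * N) * (Q * e)                        ≤⟨ *-monoˡ-≤ (Q * e) N≤ ⟩
    ((e + K) ^ k * P) * (Q * e)              ≡⟨ r₂ ((e + K) ^ k) P Q e ⟩
    ((e + K) ^ k * e) * (P * Q)              ≤⟨ *-monoˡ-≤ (P * Q) (^-growth K k e) ⟩
    (e ^ k * (e + G)) * (P * Q)              ≡⟨ r₃ (e ^ k) e G P Q ⟩
    (e ^ k * Q) * (P * e + G * P)            ≤⟨ *-monoˡ-≤ (P * e + G * P) ≤T ⟩
    (F * T) * (P * e + G * P)                ≡⟨ r₄ F T P e G ⟩
    F * (P * T * e + G * P * T)              ∎)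
  below : P * T * e ≤ N * Q * e + G * P * T
  below = *-cancelˡ-≤ F (begin
    F * (P * T * e)                          ≡⟨ r₅ F P T e ⟩
    (F * T) * (P * e)                        ≤⟨ *-monoˡ-≤ (P * e) T≤ ⟩
    ((e + K) ^ k * Q) * (P * e)              ≡⟨ r₈ ((e + K) ^ k) Q P e ⟩
    ((e + K) ^ k * e) * (P * Q)              ≤⟨ *-monoˡ-≤ (P * Q) (^-growth K k e) ⟩
    (e ^ k * (e + G)) * (P * Q)              ≡⟨ r₆ (e ^ k) e G P Q ⟩
    -- The main term uses the lower bound for `N`, the error term the one for `T`; so the error
    -- comes out as `G * P * T`, just as in `above`.
    (e ^ k * P) * (Q * e) + (e ^ k * Q) * (G * P) ≤⟨ +-mono-≤ (*-monoˡ-≤ (Q * e) ≤N) (*-monoˡ-≤ (G * P) ≤T) ⟩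
    (F * N) * (Q * e) + (F * T) * (G * P)    ≡⟨ r₇ F N Q e T G P ⟩
    F * (N * Q * e + G * P * T)              ∎)

-- Densities along a sequence of inflations.

module _ {n} (π : Permutation′ n) (up : Fin n → Bool) where
  open Inflation π up using (inflation)

  blocks : List Block
  -- The `0` is a placeholder: `block` is the same for every run length.
  blocks = tabulate (Inflation.block π up 0)

  -- The run length is `e + K` with `e = suc m`: `e` is positive, as `^-growth` requires, and `K` is
  -- to be at least the size of the patterns counted.
  inflations : ℕ → ℕ → Perm
  inflations K m = n * (suc m + K) , inflation (suc m + K)

  inflations-→∞ : 0 < n → ∀ K → SizesToInfinity (inflations K)
  inflations-→∞ n>0 K M = M , λ m M≤m → begin
    M                 ≤⟨ M≤m ⟩
    m                 ≤⟨ m≤n+m m 1 ⟩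
    suc m             ≤⟨ m≤m+n (suc m) K ⟩
    suc m + K         ≤⟨ m≤n*m (suc m + K) n ⦃ ℕ.>-nonZero n>0 ⦄ ⟩
    n * (suc m + K)   ∎
    where open ≤-Reasoning

  density-inflations : ∀ {k} K (σ : Permutation′ k) → k ≤ K → 0 < weightedSum k blocks (λ _ → 1) →
    (λ m → density σ (proj₂ (inflations K m))) ⟶
    frac (weightedSum k blocks (indicator ∘ agrees (toList (word σ)))) (weightedSum k blocks (λ _ → 1))
  density-inflations {k} K σ k≤K Q>0 = frac-⟶ N T P Q (growth K k * P) Q>0 T>0 λ m →
    ≤-trans (cross-bound K k (suc m) (N m) (T m) P Q (≤-N m) (N-≤ m) (≤-T m) (T-≤ m))
            (*-monoʳ-≤ (growth K k * P) (m≤m*n (T m) Q ⦃ ℕ.>-nonZero Q>0 ⦄))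
    where
    g = indicator ∘ agrees (toList (word σ))
    P = weightedSum k blocks g
    Q = weightedSum k blocks (λ _ → 1)
    N T : ℕ → ℕ
    N m = occurrences σ (proj₂ (inflations K m))
    T m = length (increasing k (n * (suc m + K)))
    ≤-N : ∀ m → k ! * N m ≤ (suc m + K) ^ k * P
    ≤-N m rewrite count-inflation σ π up (suc m + K) = sublistSum-inflate-≤ k (suc m + K) blocks g
    N-≤ : ∀ m → suc m ^ k * P ≤ k ! * N m
    N-≤ m rewrite count-inflation σ π up (suc m + K) = sublistSum-inflate-≥ k (suc m) K blocks g k≤K
    ≤-T : ∀ m → k ! * T m ≤ (suc m + K) ^ k * Q
    ≤-T m rewrite size-inflation σ π up (suc m + K) = sublistSum-inflate-≤ k (suc m + K) blocks (λ _ → 1)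
    T-≤ : ∀ m → suc m ^ k * Q ≤ k ! * T m
    T-≤ m rewrite size-inflation σ π up (suc m + K) = sublistSum-inflate-≥ k (suc m) K blocks (λ _ → 1) k≤K
    T>0 : ∀ m → 0 < T m
    -- The lower bound `T-≤` has a positive left side, which excludes `T m = 0`.
    T>0 m = n≢0⇒n>0 λ T≡0 → <⇒≱ (*-mono-≤ (m^n>0 (suc m) k) Q>0)
      (≤-trans (T-≤ m) (≤-reflexive (trans (cong (k ! *_) T≡0) (*-zeroʳ (k !)))))

-- The table of skeletons

infix 8 _↗ _↘

_↗ _↘ : ℕ → Block
v ↗ = v , true
v ↘ = v , false

Word : Set
Word = Vec (Fin 4) 4

digits : ℕ → ℕ → ℕ → ℕ → Word
digits a b c d = Vec.map digit (a ∷ b ∷ c ∷ d ∷ [])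
  where
  digit : ℕ → Fin 4
  digit 1 = # 0
  digit 2 = # 1
  digit 3 = # 2
  -- The table has only the digits 1 to 4, so this clause stands for 4.
  digit _ = # 3

record Row : Set where
  constructor row
  field
    quadruple : List Word
    {size-1}  : ℕ
    profile   : Vec Block (suc size-1)

  size : ℕ
  size = suc size-1

  value : Fin size → Fin size
  -- Reduction modulo `size` only serves to land in `Fin size`; `Invertible` checks that it changes
  -- no entry.
  value i = proj₁ (lookup profile i) mod size

  up : Fin size → Bool
  up i = proj₂ (lookup profile i)

  -- The inverse of value; the default zero is ruled out by Invertible.
  position : Fin size → Fin size
  position j with Fin.any? (λ i → value i Fin.≟ j)
  ... | yes (i , _) = i
  ... | no  _       = zero

-- The equation P / Q = 1 / k! cleared of denominators, as a boolean on naturals that evaluation can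
-- decide.
balancedᵇ : ∀ {k} → List Block → Vec ℕ k → Bool
balancedᵇ {k} bs w = k ℕ.! * weightedSum k bs (indicator ∘ agrees (toList w)) ≡ᵇ weightedSum k bs (λ _ → 1)

all-true⁻ : ∀ {X : Set} {p : X → Bool} {xs x} → all p xs ≡ true → x ∈ xs → p x ≡ true
all-true⁻ {p = p} {xs = y ∷ _} eq (here refl) = proj₁ (∧-true⁻ {p y} eq)
all-true⁻ {p = p} {xs = y ∷ _} eq (there x∈)  = all-true⁻ (proj₂ (∧-true⁻ {p y} eq)) x∈

not-true⁻ : ∀ {b} → not b ≡ true → b ≡ false
not-true⁻ {false} _ = refl

nonemptyᵇ : ℕ → List Block → Bool
nonemptyᵇ k bs = 0 ℕ.<ᵇ weightedSum k bs (λ _ → 1)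

Invertible : Row → Set
Invertible r = (∀ i → toℕ (value i) ≡ proj₁ (lookup profile i)) ×
               (∀ j → value (position j) ≡ j) × (∀ i → position (value i) ≡ i)
  where open Row r

invertible? : ∀ r → Dec (Invertible r)
invertible? r = Fin.all? (λ i → toℕ (value i) ℕ.≟ proj₁ (lookup profile i)) ×-dec
                Fin.all? (λ j → value (position j) Fin.≟ j) ×-dec Fin.all? (λ i → position (value i) Fin.≟ i)
  where open Row r

validᵇ : Row → Bool
validᵇ r = ⌊ invertible? r ⌋ ∧ (nonemptyᵇ 3 bs ∧ nonemptyᵇ 4 bs) ∧
           all (balancedᵇ bs ∘ Vec.map toℕ) (Row.quadruple r) ∧ not (balancedᵇ bs (word {3} id))
  where bs = toList (Row.profile r)

toList≡tabulate : ∀ {X : Set} {n} (xs : Vec X n) → tabulate (lookup xs) ≡ toList xs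
toList≡tabulate []       = refl
toList≡tabulate (x ∷ xs) = cong (x ∷_) (toList≡tabulate xs)

frac≡1/ : ∀ k P Q → 0 < Q → k ℕ.! * P ≡ Q → frac P Q ≡ frac 1 (k ℕ.!)
-- `frac` unfolds only at a successor, so `k !` is abstracted together with the proof that it is
-- nonzero.
frac≡1/ k P (suc Q) _ eq with k ℕ.! | k ℕ.!≢0
... | suc f | _ = frac-≡⁺ P Q 1 f (trans (ℕ.*-comm P (suc f)) (trans eq (sym (ℕ.*-identityˡ _))))

frac≡1/⁻ : ∀ k P Q → 0 < Q → frac P Q ≡ frac 1 (k ℕ.!) → k ℕ.! * P ≡ Q
frac≡1/⁻ k P (suc Q) _ eq with k ℕ.! | k ℕ.!≢0
... | suc f | _ = trans (ℕ.*-comm (suc f) P) (trans (frac-≡⁻ P Q 1 f eq) (ℕ.*-identityˡ _))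

module Valid (r : Row) (v : validᵇ r ≡ true) where
  open Row r

  bs : List Block
  bs = toList profile

  private
    parts₁ : ⌊ invertible? r ⌋ ≡ true × _
    parts₁ = ∧-true⁻ {⌊ invertible? r ⌋} v
    parts₂ : (nonemptyᵇ 3 bs ∧ nonemptyᵇ 4 bs) ≡ true × _
    parts₂ = ∧-true⁻ {nonemptyᵇ 3 bs ∧ nonemptyᵇ 4 bs} (proj₂ parts₁)
    parts₃ : nonemptyᵇ 3 bs ≡ true × nonemptyᵇ 4 bs ≡ true
    parts₃ = ∧-true⁻ {nonemptyᵇ 3 bs} (proj₁ parts₂)
    parts₄ : all (balancedᵇ bs ∘ Vec.map toℕ) quadruple ≡ true × not (balancedᵇ bs (word {3} id)) ≡ true
    parts₄ = ∧-true⁻ {all (balancedᵇ bs ∘ Vec.map toℕ) quadruple} (proj₂ parts₂)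

  invertible : Invertible r
  invertible = toWitness (Equivalence.from T-≡ (proj₁ parts₁))

  nonempty₃ : 0 < weightedSum 3 bs (λ _ → 1)
  nonempty₃ = ℕ.<ᵇ⇒< 0 _ (Equivalence.from T-≡ (proj₁ parts₃))

  nonempty₄ : 0 < weightedSum 4 bs (λ _ → 1)
  nonempty₄ = ℕ.<ᵇ⇒< 0 _ (Equivalence.from T-≡ (proj₂ parts₃))

  balanced : ∀ {w} → w ∈ quadruple → Bool.T (balancedᵇ bs (Vec.map toℕ w))
  balanced = Equivalence.from T-≡ ∘ all-true⁻ (proj₁ parts₄)

  unbalanced : ¬ Bool.T (balancedᵇ bs (word {3} id))
  unbalanced t = contradiction (trans (sym (Equivalence.to T-≡ t)) (not-true⁻ (proj₂ parts₄))) λ ()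

  skeleton : Permutation′ size
  skeleton = permutation value position (proj₁ (proj₂ invertible)) (proj₂ (proj₂ invertible))

  blocks≡profile : blocks skeleton up ≡ bs
  blocks≡profile = trans (tabulate-cong (λ i → cong (_, up i) (proj₁ invertible i))) (toList≡tabulate profile)

  -- The choice `K = 4` covers patterns of size 3 and 4 at once: the four patterns and 123 must be
  -- measured along one and the same sequence.
  density-skeleton : ∀ {k} (σ : Permutation′ k) → k ≤ 4 → 0 < weightedSum k bs (λ _ → 1) →
    (λ m → density σ (proj₂ (inflations skeleton up 4 m))) ⟶
    frac (weightedSum k bs (indicator ∘ agrees (toList (word σ)))) (weightedSum k bs (λ _ → 1))
  density-skeleton {k} σ k≤4 Q>0 = subst
    (λ bs′ → (λ m → density σ (proj₂ (inflations skeleton up 4 m))) ⟶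
       frac (weightedSum k bs′ (indicator ∘ agrees (toList (word σ)))) (weightedSum k bs′ (λ _ → 1)))
    blocks≡profile
    (density-inflations skeleton up 4 σ k≤4 (subst (λ bs′ → 0 < weightedSum k bs′ (λ _ → 1)) (sym blocks≡profile) Q>0))

  quasirandom : (σ : Permutation′ 4) → oneLine σ ∈ quadruple → DensityQuasirandom (inflations skeleton up 4) (4 , σ)
  quasirandom σ σ∈ = subst ((λ m → density σ (proj₂ (inflations skeleton up 4 m))) ⟶_)
    (frac≡1/ 4 (weightedSum 4 bs (indicator ∘ agrees (toList (word σ)))) (weightedSum 4 bs (λ _ → 1)) nonempty₄ (ℕ.≡ᵇ⇒≡ _ _ (balanced σ∈)))
    (density-skeleton σ ℕ.≤-refl nonempty₄)

  quasirandoms : ∀ σs → All (λ σ → oneLine σ ∈ quadruple) σs →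
    All (DensityQuasirandom (inflations skeleton up 4)) (map (4 ,_) σs)
  quasirandoms []       []         = []
  quasirandoms (σ ∷ σs) (σ∈ ∷ σs∈) = quasirandom σ σ∈ ∷ quasirandoms σs σs∈

  -- Forcing would send the density of 123 to 1 / 6 along a sequence on which it tends to a
  -- different fraction, against uniqueness of limits.
  not-forcing : ∀ σs → All (λ σ → oneLine σ ∈ quadruple) σs → ¬ QuasirandomForcing (map (4 ,_) σs)
  not-forcing σs σs∈ forcing = ⟶-unique {λ m → density {3} id (proj₂ (inflations skeleton up 4 m))}
    (density-skeleton {3} id (ℕ.n≤1+n 3) nonempty₃)
    (forcing (inflations skeleton up 4) (inflations-→∞ skeleton up z<s 4) (quasirandoms σs σs∈) (3 , id))
    (unbalanced ∘ ℕ.≡⇒≡ᵇ _ _ ∘ frac≡1/⁻ 3 (weightedSum 3 bs (indicator ∘ agrees (toList (word {3} id)))) (weightedSum 3 bs (λ _ → 1)) nonempty₃)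

-- Found by computer search; rows of quadruples that are related by reversal and
-- inversion are related in the same way.
rows : List Row
rows =
  row (digits 1 2 3 4 ∷ digits 2 1 4 3 ∷ digits 3 4 2 1 ∷ digits 4 3 1 2 ∷ [])
      (16 ↗ ∷ 17 ↘ ∷ 10 ↘ ∷ 8 ↗ ∷ 6 ↗ ∷ 7 ↗ ∷ 5 ↘ ∷ 9 ↗ ∷ 15 ↘ ∷ 14 ↘ ∷ 19 ↘ ∷ 20 ↘ ∷
       22 ↘ ∷ 18 ↘ ∷ 21 ↘ ∷ 23 ↗ ∷ 1 ↘ ∷ 0 ↘ ∷ 3 ↘ ∷ 2 ↘ ∷ 4 ↗ ∷ 12 ↗ ∷ 11 ↘ ∷ 13 ↘ ∷ []) ∷
  row (digits 1 2 3 4 ∷ digits 2 3 4 1 ∷ digits 3 4 1 2 ∷ digits 4 1 2 3 ∷ [])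
      (9 ↗ ∷ 5 ↗ ∷ 6 ↗ ∷ 4 ↘ ∷ 3 ↘ ∷ 1 ↗ ∷ 2 ↗ ∷ 10 ↗ ∷ 11 ↘ ∷ 0 ↗ ∷ 7 ↗ ∷ 8 ↘ ∷ []) ∷
  row (digits 1 2 3 4 ∷ digits 2 4 1 3 ∷ digits 3 1 4 2 ∷ digits 4 3 2 1 ∷ [])
      (6 ↘ ∷ 10 ↘ ∷ 22 ↘ ∷ 15 ↗ ∷ 14 ↘ ∷ 12 ↗ ∷ 11 ↘ ∷ 13 ↗ ∷ 23 ↘ ∷ 2 ↘ ∷ 0 ↗ ∷ 4 ↘ ∷
       1 ↘ ∷ 3 ↗ ∷ 7 ↘ ∷ 19 ↗ ∷ 17 ↗ ∷ 18 ↗ ∷ 21 ↘ ∷ 20 ↘ ∷ 9 ↘ ∷ 5 ↘ ∷ 8 ↘ ∷ 16 ↘ ∷ []) ∷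
  row (digits 1 2 4 3 ∷ digits 2 1 3 4 ∷ digits 3 4 1 2 ∷ digits 4 3 2 1 ∷ [])
      (13 ↗ ∷ 11 ↗ ∷ 12 ↘ ∷ 4 ↘ ∷ 2 ↗ ∷ 3 ↗ ∷ 0 ↗ ∷ 1 ↗ ∷ 23 ↘ ∷ 21 ↗ ∷ 18 ↗ ∷ 22 ↗ ∷
       20 ↗ ∷ 19 ↗ ∷ 14 ↗ ∷ 15 ↗ ∷ 9 ↘ ∷ 5 ↗ ∷ 7 ↘ ∷ 6 ↘ ∷ 8 ↘ ∷ 10 ↗ ∷ 17 ↗ ∷ 16 ↘ ∷ []) ∷
  row (digits 1 2 4 3 ∷ digits 2 1 3 4 ∷ digits 3 4 2 1 ∷ digits 4 3 1 2 ∷ [])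
      (5 ↗ ∷ 9 ↘ ∷ 7 ↗ ∷ 1 ↘ ∷ 4 ↘ ∷ 3 ↗ ∷ 2 ↗ ∷ 11 ↗ ∷ 10 ↗ ∷ 6 ↗ ∷ 8 ↘ ∷ 0 ↗ ∷ []) ∷
  row (digits 1 2 4 3 ∷ digits 2 3 1 4 ∷ digits 3 4 2 1 ∷ digits 4 1 3 2 ∷ [])
      (7 ↗ ∷ 5 ↗ ∷ 10 ↘ ∷ 2 ↗ ∷ 0 ↘ ∷ 4 ↘ ∷ 9 ↘ ∷ 3 ↘ ∷ 11 ↘ ∷ 1 ↘ ∷ 6 ↗ ∷ 8 ↘ ∷ []) ∷
  row (digits 1 2 4 3 ∷ digits 2 4 3 1 ∷ digits 3 1 2 4 ∷ digits 4 3 1 2 ∷ [])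
      (4 ↘ ∷ 9 ↘ ∷ 3 ↗ ∷ 7 ↘ ∷ 5 ↘ ∷ 1 ↗ ∷ 10 ↗ ∷ 0 ↗ ∷ 11 ↘ ∷ 6 ↘ ∷ 2 ↘ ∷ 8 ↘ ∷ []) ∷
  row (digits 1 3 2 4 ∷ digits 2 1 4 3 ∷ digits 3 4 1 2 ∷ digits 4 2 3 1 ∷ [])
      (13 ↗ ∷ 21 ↘ ∷ 1 ↗ ∷ 8 ↘ ∷ 5 ↘ ∷ 19 ↗ ∷ 16 ↗ ∷ 6 ↘ ∷ 20 ↗ ∷ 11 ↗ ∷ 0 ↘ ∷ 14 ↘ ∷
       9 ↘ ∷ 23 ↘ ∷ 12 ↗ ∷ 3 ↗ ∷ 17 ↘ ∷ 7 ↗ ∷ 4 ↗ ∷ 18 ↘ ∷ 15 ↘ ∷ 22 ↗ ∷ 2 ↘ ∷ 10 ↗ ∷ []) ∷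
  row (digits 1 3 2 4 ∷ digits 2 4 1 3 ∷ digits 3 2 4 1 ∷ digits 4 1 3 2 ∷ [])
      (4 ↗ ∷ 7 ↘ ∷ 3 ↘ ∷ 11 ↗ ∷ 0 ↘ ∷ 1 ↘ ∷ 6 ↘ ∷ 9 ↗ ∷ 8 ↘ ∷ 5 ↗ ∷ 10 ↗ ∷ 2 ↘ ∷ []) ∷
  row (digits 1 3 2 4 ∷ digits 2 4 3 1 ∷ digits 3 1 4 2 ∷ digits 4 2 1 3 ∷ [])
      (4 ↘ ∷ 5 ↘ ∷ 11 ↘ ∷ 2 ↘ ∷ 0 ↗ ∷ 9 ↗ ∷ 6 ↘ ∷ 1 ↘ ∷ 8 ↘ ∷ 7 ↗ ∷ 10 ↗ ∷ 3 ↗ ∷ []) ∷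
  row (digits 1 3 4 2 ∷ digits 2 1 3 4 ∷ digits 3 4 2 1 ∷ digits 4 2 1 3 ∷ [])
      (8 ↗ ∷ 2 ↗ ∷ 6 ↗ ∷ 11 ↗ ∷ 0 ↘ ∷ 10 ↘ ∷ 1 ↘ ∷ 5 ↗ ∷ 7 ↗ ∷ 3 ↘ ∷ 9 ↗ ∷ 4 ↗ ∷ []) ∷
  row (digits 1 3 4 2 ∷ digits 2 4 1 3 ∷ digits 3 1 2 4 ∷ digits 4 2 3 1 ∷ [])
      (3 ↘ ∷ 10 ↘ ∷ 7 ↘ ∷ 8 ↗ ∷ 1 ↗ ∷ 6 ↗ ∷ 9 ↘ ∷ 0 ↘ ∷ 2 ↗ ∷ 11 ↗ ∷ 5 ↗ ∷ 4 ↗ ∷ []) ∷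
  row (digits 1 3 4 2 ∷ digits 2 4 3 1 ∷ digits 3 1 2 4 ∷ digits 4 2 1 3 ∷ [])
      (2 ↘ ∷ 10 ↘ ∷ 5 ↘ ∷ 4 ↗ ∷ 0 ↗ ∷ 3 ↗ ∷ 8 ↗ ∷ 11 ↗ ∷ 7 ↗ ∷ 6 ↘ ∷ 1 ↘ ∷ 9 ↗ ∷ []) ∷
  row (digits 1 3 4 2 ∷ digits 2 4 3 1 ∷ digits 3 2 1 4 ∷ digits 4 1 2 3 ∷ [])
      (4 ↘ ∷ 10 ↗ ∷ 2 ↘ ∷ 9 ↗ ∷ 1 ↗ ∷ 8 ↘ ∷ 11 ↗ ∷ 3 ↘ ∷ 5 ↘ ∷ 7 ↗ ∷ 0 ↘ ∷ 6 ↘ ∷ []) ∷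
  row (digits 1 4 2 3 ∷ digits 2 1 3 4 ∷ digits 3 2 4 1 ∷ digits 4 3 1 2 ∷ [])
      (4 ↘ ∷ 6 ↘ ∷ 1 ↗ ∷ 9 ↘ ∷ 11 ↗ ∷ 7 ↗ ∷ 2 ↗ ∷ 8 ↗ ∷ 0 ↗ ∷ 10 ↗ ∷ 5 ↘ ∷ 3 ↗ ∷ []) ∷
  row (digits 1 4 2 3 ∷ digits 2 3 1 4 ∷ digits 3 1 4 2 ∷ digits 4 2 3 1 ∷ [])
      (2 ↗ ∷ 10 ↘ ∷ 5 ↘ ∷ 8 ↗ ∷ 9 ↘ ∷ 6 ↗ ∷ 1 ↗ ∷ 0 ↗ ∷ 11 ↘ ∷ 3 ↗ ∷ 7 ↗ ∷ 4 ↘ ∷ []) ∷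
  row (digits 1 4 2 3 ∷ digits 2 3 1 4 ∷ digits 3 2 4 1 ∷ digits 4 1 3 2 ∷ [])
      (4 ↗ ∷ 10 ↘ ∷ 0 ↘ ∷ 5 ↗ ∷ 3 ↗ ∷ 2 ↘ ∷ 9 ↘ ∷ 8 ↗ ∷ 6 ↗ ∷ 11 ↗ ∷ 1 ↘ ∷ 7 ↗ ∷ []) ∷
  row (digits 1 4 2 3 ∷ digits 2 3 4 1 ∷ digits 3 2 1 4 ∷ digits 4 1 3 2 ∷ [])
      (10 ↘ ∷ 4 ↗ ∷ 2 ↘ ∷ 7 ↘ ∷ 0 ↘ ∷ 8 ↘ ∷ 11 ↘ ∷ 9 ↗ ∷ 5 ↘ ∷ 3 ↗ ∷ 1 ↗ ∷ 6 ↗ ∷ []) ∷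
  row (digits 1 4 3 2 ∷ digits 2 1 4 3 ∷ digits 3 2 1 4 ∷ digits 4 3 2 1 ∷ [])
      (8 ↗ ∷ 7 ↘ ∷ 0 ↘ ∷ 11 ↗ ∷ 10 ↘ ∷ 2 ↘ ∷ 1 ↘ ∷ 3 ↗ ∷ 4 ↗ ∷ 6 ↘ ∷ 5 ↘ ∷ 9 ↘ ∷ []) ∷
  row (digits 1 4 3 2 ∷ digits 2 3 1 4 ∷ digits 3 2 4 1 ∷ digits 4 1 2 3 ∷ [])
      (6 ↘ ∷ 1 ↘ ∷ 3 ↘ ∷ 5 ↗ ∷ 9 ↘ ∷ 11 ↗ ∷ 8 ↗ ∷ 0 ↗ ∷ 7 ↗ ∷ 2 ↗ ∷ 4 ↘ ∷ 10 ↗ ∷ []) ∷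
  row (digits 1 4 3 2 ∷ digits 2 3 4 1 ∷ digits 3 1 2 4 ∷ digits 4 2 1 3 ∷ [])
      (7 ↗ ∷ 1 ↘ ∷ 9 ↗ ∷ 2 ↘ ∷ 10 ↘ ∷ 3 ↗ ∷ 0 ↘ ∷ 8 ↗ ∷ 6 ↗ ∷ 4 ↘ ∷ 11 ↗ ∷ 5 ↗ ∷ []) ∷
  row (digits 1 4 3 2 ∷ digits 2 3 4 1 ∷ digits 3 2 1 4 ∷ digits 4 1 2 3 ∷ [])
      (17 ↘ ∷ 19 ↗ ∷ 11 ↗ ∷ 18 ↘ ∷ 1 ↘ ∷ 3 ↗ ∷ 0 ↗ ∷ 10 ↘ ∷ 14 ↘ ∷ 8 ↗ ∷ 16 ↗ ∷ 21 ↘ ∷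
       2 ↘ ∷ 7 ↗ ∷ 15 ↗ ∷ 9 ↘ ∷ 13 ↘ ∷ 23 ↗ ∷ 20 ↗ ∷ 22 ↘ ∷ 5 ↘ ∷ 12 ↗ ∷ 4 ↗ ∷ 6 ↘ ∷ []) ∷
  []

-- Evaluation is feasible because `weightedSum` runs over multisets of blocks: for 24 blocks and a
-- pattern of size 4 there are C(27, 4) = 17550 of them, against 24⁴ tuples.
rows-valid : all validᵇ rows ≡ true
rows-valid = refl

-- Classification of the quadruples

-- A semi-decision: `just` carries a rearrangement, built by pulling each word out of `vs` in turn,
-- while `nothing` asserts nothing.
perm? : (ws vs : List Word) → Maybe (ws ↭ vs)
perm? []       []      = just ↭-refl
perm? []       (_ ∷ _) = nothing
perm? (w ∷ ws) vs with w ∈? vs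
... | no  _    = nothing
... | yes w∈vs with ls , rs , refl ← ∈-∃++ w∈vs =
  Maybe.map (λ ws↭ → ↭-trans (prep w ws↭) (↭-sym (shift w ls rs))) (perm? ws (ls ++ rs))

exceptional₁ exceptional₂ : List Word
exceptional₁ = w1234 ∷ w2143 ∷ w3412 ∷ w4321 ∷ []
exceptional₂ = w1324 ∷ w2413 ∷ w3142 ∷ w4231 ∷ []

-- Containment in a row is enough, in any order, since every pattern of the row has limit density 1
-- / 24 along the same sequence.
Tabulated : List Word → Set
Tabulated ws = Any (λ r → All (_∈ Row.quadruple r) ws) rows

tabulated? : ∀ ws → Dec (Tabulated ws)
tabulated? ws = any? (λ r → all? (_∈? Row.quadruple r) ws) rows

Classified : List Word → Set
Classified ws = ws ↭ exceptional₁ ⊎ ws ↭ exceptional₂ ⊎ Tabulated ws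

classify : ∀ ws → Maybe (Classified ws)
classify ws =
  Maybe.map (inj₂ ∘ inj₂) (dec⇒maybe (tabulated? ws)) <∣>
  Maybe.map inj₁ (perm? ws exceptional₁) <∣>
  Maybe.map (inj₂ ∘ inj₁) (perm? ws exceptional₂)

words : ∀ k → List (Vec (Fin 4) k)
words zero    = [] ∷ []
words (suc k) = concatMap (λ i → map (i ∷_) (words k)) (allFin 4)

∈-words : ∀ {k} (w : Vec (Fin 4) k) → w ∈ words k
∈-words []      = here refl
∈-words (i ∷ w) = ∈-concatMap⁺ (λ i → map (i ∷_) (words _)) {xs = allFin 4} (lose (∈-allFin i) (∈-map⁺ (i ∷_) (∈-words w)))

Distinct : Word → Set
Distinct w = ∀ i j → lookup w i ≡ lookup w j → i ≡ j

distinct? : ∀ w → Dec (Distinct w)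
distinct? w = Fin.all? λ i → Fin.all? λ j → (lookup w i Fin.≟ lookup w j) →-dec (i Fin.≟ j)

Disjoint : Word → Word → Set
Disjoint v w = ∀ i → lookup v i ≢ lookup w i

disjoint? : ∀ v w → Dec (Disjoint v w)
disjoint? v w = Fin.all? λ i → ¬? (lookup v i Fin.≟ lookup w i)

permutations : List Word
permutations = filter distinct? (words 4)

-- The candidates are filtered after every choice, so `classify` meets only pairwise disjoint
-- quadruples. These are the 576 Latin squares of order 4, that is 24 unordered quadruples: the two
-- exceptional ones and the 22 rows.
classified₄ : Word → Word → Word → Word → Bool
classified₄ w₁ w₂ w₃ w₄ = is-just (classify (w₁ ∷ w₂ ∷ w₃ ∷ w₄ ∷ []))

classified₃ : List Word → Word → Word → Word → Bool
classified₃ ws w₁ w₂ w₃ = all (classified₄ w₁ w₂ w₃) (filter (disjoint? w₃) ws)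

classified₂ : List Word → Word → Word → Bool
classified₂ ws w₁ w₂ = let ws₃ = filter (disjoint? w₂) ws in all (classified₃ ws₃ w₁ w₂) ws₃

classified₁ : Word → Bool
classified₁ w₁ = let ws₂ = filter (disjoint? w₁) permutations in all (classified₂ ws₂ w₁) ws₂

all-classified : all classified₁ permutations ≡ true
all-classified = refl

latin-classified : ∀ {w₁ w₂ w₃ w₄} → Distinct w₁ → Distinct w₂ → Distinct w₃ → Distinct w₄ →
  Disjoint w₁ w₂ → Disjoint w₁ w₃ → Disjoint w₁ w₄ → Disjoint w₂ w₃ → Disjoint w₂ w₄ → Disjoint w₃ w₄ →
  Classified (w₁ ∷ w₂ ∷ w₃ ∷ w₄ ∷ [])
latin-classified {w₁} {w₂} {w₃} {w₄} d₁ d₂ d₃ d₄ d₁₂ d₁₃ d₁₄ d₂₃ d₂₄ d₃₄ =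
  to-witness-T (classify (w₁ ∷ w₂ ∷ w₃ ∷ w₄ ∷ [])) (Equivalence.from T-≡ true₄)
  where
  ∈-permutations : ∀ w → Distinct w → w ∈ permutations
  ∈-permutations w = ∈-filter⁺ distinct? (∈-words w)
  ws₂ ws₃ : List Word
  ws₂ = filter (disjoint? w₁) permutations
  ws₃ = filter (disjoint? w₂) ws₂
  ∈-ws₃ : ∀ w → Distinct w → Disjoint w₁ w → Disjoint w₂ w → w ∈ ws₃
  ∈-ws₃ w d d₁ d₂ = ∈-filter⁺ (disjoint? w₂) (∈-filter⁺ (disjoint? w₁) (∈-permutations w d) d₁) d₂
  true₁ : classified₁ w₁ ≡ true
  true₁ = all-true⁻ {p = classified₁} {xs = permutations} all-classified (∈-permutations w₁ d₁)
  true₂ : classified₂ ws₂ w₁ w₂ ≡ true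
  true₂ = all-true⁻ {p = classified₂ ws₂ w₁} {xs = ws₂} true₁ (∈-filter⁺ (disjoint? w₁) (∈-permutations w₂ d₂) d₁₂)
  true₃ : classified₃ ws₃ w₁ w₂ w₃ ≡ true
  true₃ = all-true⁻ {p = classified₃ ws₃ w₁ w₂} {xs = ws₃} true₂ (∈-ws₃ w₃ d₃ d₁₃ d₂₃)
  true₄ : classified₄ w₁ w₂ w₃ w₄ ≡ true
  true₄ = all-true⁻ {p = classified₄ w₁ w₂ w₃} {xs = filter (disjoint? w₃) ws₃} true₃
    (∈-filter⁺ (disjoint? w₃) (∈-ws₃ w₄ d₄ d₁₄ d₂₄) d₃₄)

oneLine-distinct : ∀ π → Distinct (oneLine π)
oneLine-distinct π i j eq = injective π (trans (sym (Vec.lookup∘tabulate (π ⟨$⟩ʳ_) i)) (trans eq (Vec.lookup∘tabulate (π ⟨$⟩ʳ_) j)))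

A-agree : ∀ {n} (π : Permutation′ n) {i j} → π ⟨$⟩ʳ i ≡ j → A π i j ≡ 1
A-agree π {i} {j} eq with (π ⟨$⟩ʳ i) Fin.≟ j
... | yes _  = refl
... | no neq = contradiction eq neq

-- Two permutations agreeing at `i` would both put a 1 into the same cell, and the sum there would
-- be at least 2. Collecting the other two matrices in `rest` lets one lemma treat all six pairs.
oneLine-disjoint : ∀ π ρ (rest : Fin 4 → Fin 4 → ℕ) → (∀ i j → A π i j + A ρ i j + rest i j ≡ 1) →
  Disjoint (oneLine π) (oneLine ρ)
oneLine-disjoint π ρ rest sum≡1 i eq = too-big (sum≡1 i (π ⟨$⟩ʳ i))
  where
  ρi≡πi : ρ ⟨$⟩ʳ i ≡ π ⟨$⟩ʳ i
  ρi≡πi = trans (sym (Vec.lookup∘tabulate (ρ ⟨$⟩ʳ_) i)) (trans (sym eq) (Vec.lookup∘tabulate (π ⟨$⟩ʳ_) i))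
  too-big : A π i (π ⟨$⟩ʳ i) + A ρ i (π ⟨$⟩ʳ i) + rest i (π ⟨$⟩ʳ i) ≢ 1
  too-big rewrite A-agree π {i} refl | A-agree ρ ρi≡πi = λ ()

module _ (π₁ π₂ π₃ π₄ : Permutation′ 4)
         (latin : ∀ (i j : Fin 4) → A π₁ i j + A π₂ i j + A π₃ i j + A π₄ i j ≡ 1) where

  private
    split₁₂ : ∀ a b c d → a + b + (c + d) ≡ a + b + c + d
    split₁₂ = solve-∀
    split₁₃ : ∀ a b c d → a + c + (b + d) ≡ a + b + c + d
    split₁₃ = solve-∀
    split₁₄ : ∀ a b c d → a + d + (b + c) ≡ a + b + c + d
    split₁₄ = solve-∀
    split₂₃ : ∀ a b c d → b + c + (a + d) ≡ a + b + c + d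
    split₂₃ = solve-∀
    split₂₄ : ∀ a b c d → b + d + (a + c) ≡ a + b + c + d
    split₂₄ = solve-∀
    split₃₄ : ∀ a b c d → c + d + (a + b) ≡ a + b + c + d
    split₃₄ = solve-∀

    disjoint : ∀ π ρ π′ ρ′ →
      (∀ i j → A π i j + A ρ i j + (A π′ i j + A ρ′ i j) ≡ A π₁ i j + A π₂ i j + A π₃ i j + A π₄ i j) →
      Disjoint (oneLine π) (oneLine ρ)
    disjoint π ρ π′ ρ′ split = oneLine-disjoint π ρ (λ i j → A π′ i j + A ρ′ i j) λ i j → trans (split i j) (latin i j)

  quadruple-classified : Classified (oneLine π₁ ∷ oneLine π₂ ∷ oneLine π₃ ∷ oneLine π₄ ∷ [])
  quadruple-classified = latin-classified
    (oneLine-distinct π₁) (oneLine-distinct π₂) (oneLine-distinct π₃) (oneLine-distinct π₄)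
    (disjoint π₁ π₂ π₃ π₄ λ i j → split₁₂ (A π₁ i j) _ _ _)
    (disjoint π₁ π₃ π₂ π₄ λ i j → split₁₃ (A π₁ i j) _ _ _)
    (disjoint π₁ π₄ π₂ π₃ λ i j → split₁₄ (A π₁ i j) _ _ _)
    (disjoint π₂ π₃ π₁ π₄ λ i j → split₂₃ (A π₁ i j) _ _ _)
    (disjoint π₂ π₄ π₁ π₃ λ i j → split₂₄ (A π₁ i j) _ _ _)
    (disjoint π₃ π₄ π₁ π₂ λ i j → split₃₄ (A π₁ i j) _ _ _)

tabulated⇒¬forcing : ∀ σs → Tabulated (map oneLine σs) → ¬ QuasirandomForcing (map (4 ,_) σs)
tabulated⇒¬forcing σs tabulated =
  let r , r∈rows , σs∈ = find tabulated
  in Valid.not-forcing r (all-true⁻ {p = validᵇ} {xs = rows} rows-valid r∈rows) σs (All.map⁻ σs∈)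

theorem13 : (π₁ π₂ π₃ π₄ : Permutation′ 4) →
    (∀ (i j : Fin 4) → A π₁ i j + A π₂ i j + A π₃ i j + A π₄ i j ≡ 1) →
    ¬ ((oneLine π₁ ∷ oneLine π₂ ∷ oneLine π₃ ∷ oneLine π₄ ∷ []) ↭ (w1234 ∷ w2143 ∷ w3412 ∷ w4321 ∷ [])) →
    ¬ ((oneLine π₁ ∷ oneLine π₂ ∷ oneLine π₃ ∷ oneLine π₄ ∷ []) ↭ (w1324 ∷ w2413 ∷ w3142 ∷ w4231 ∷ [])) →
    ¬ QuasirandomForcing ((4 , π₁) ∷ (4 , π₂) ∷ (4 , π₃) ∷ (4 , π₄) ∷ [])
theorem13 π₁ π₂ π₃ π₄ latin ¬exceptional₁ ¬exceptional₂ =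
  [ (λ exc → contradiction exc ¬exceptional₁) , [ (λ exc → contradiction exc ¬exceptional₂) , tabulated⇒¬forcing (π₁ ∷ π₂ ∷ π₃ ∷ π₄ ∷ []) ]′ ]′
    (quadruple-classified π₁ π₂ π₃ π₄ latin)
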